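{- For every fixed integer $d \geq 2$ there exists a constant $c = c(d) > 0$ such that for all integers $n \geq 1$, $$\mathrm{OT}_d(n) \leq \mathrm{twr}_d(c\,n).$$ Equivalently, $\mathrm{OT}_d(n) \le \mathrm{twr}_d(O(n))$, where $d$ is fixed and the implied constant depends only on $d$.
   Context: A point set (or sequence of points) in $\mathbb{R}^d$ is in general position if no $d+1$ of its members lie on a common hyperplane and, for each $1 \leq i \leq d$, no two of its members share the same $i$-th coordinate. Let $P = (p_1,\dots,p_N)$ be a sequence of points in $\mathbb{R}^d$ in general position. For $i_1 < i_2 < \cdots < i_{d+1}$, the orientation of the $(d+1)$-tuple $(p_{i_1},\dots,p_{i_{d+1}})$ is the sign ($+1$ or $-1$) of the determinant of the unique linear map sending $p_{i_2}-p_{i_1},\, p_{i_3}-p_{i_1},\dots,p_{i_{d+1}}-p_{i_1}$ to the standard basis $e_1,\dots,e_d$; equivalently, it is the sign of the determinant of the $d\times d$ matrix with columns $p_{i_2}-p_{i_1},\dots,p_{i_{d+1}}-p_{i_1}$. A point sequence in $\mathbb{R}^d$ is order-type homogeneous if all of its $(d+1)$-tuples (taken with indices in increasing order) have the same orientation. $\mathrm{OT}_d(n)$ is the smallest integer $N$ such that every $N$-element point sequence in $\mathbb{R}^d$ in general position contains an $n$-element subsequence that is order-type homogeneous. The tower function $\mathrm{twr}_k(x)$ is defined by $\mathrm{twr}_1(x) = x$ and $\mathrm{twr}_{i+1}(x) = 2^{\mathrm{twr}_i(x)}$. -}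

module Defs where

open import Algebra.Bundles using (RawRing)
import Algebra.Definitions.RawMonoid as RawMonoidDefs
open import Data.Fin.Base using (Fin; zero; suc; punchIn)
import Data.Fin.Base as Fin
open import Data.Nat.Base using (ℕ; zero; suc; _⊔_; _^_)
import Data.Nat.Base as ℕ
import Data.Nat.Properties as ℕₚ
open import Data.Product.Base using (Σ; _×_; _,_; ∃-syntax)
open import Data.Rational.Base using (ℚ; 0ℚ; 1ℚ; ½; ∣_∣)
import Data.Rational.Base as ℚ
import Data.Rational.Properties as ℚₚ
open import Data.Rational.Solver using (module +-*-Solver)
open import Data.Sign.Base using (Sign)
open import Data.Vec.Functional using (Vector)
open import Function.Base using (_∘_)
open import Level using (0ℓ)
open import Relation.Binary.Core using (_Preserves_⟶_)
open import Relation.Binary.PropositionalEquality using (_≡_; _≢_; refl; sym; cong; subst; module ≡-Reasoning)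
open import Relation.Nullary.Negation.Core using (¬_)

------------------------------------------------------------------------
-- The real numbers, as Cauchy sequences of rationals

IsCauchy : (ℕ → ℚ) → Set
IsCauchy x = ∀ ε → 0ℚ ℚ.< ε →
  ∃[ M ] (∀ m n → M ℕ.≤ m → M ℕ.≤ n → ∣ x m ℚ.- x n ∣ ℚ.< ε)

record ℝ : Set where
  constructor mkℝ
  field
    seq    : ℕ → ℚ
    cauchy : IsCauchy seq

open ℝ public

infix 4 _≈_ _<_

_≈_ : ℝ → ℝ → Set
x ≈ y = ∀ ε → 0ℚ ℚ.< ε →
  ∃[ M ] (∀ n → M ℕ.≤ n → ∣ seq x n ℚ.- seq y n ∣ ℚ.< ε)

-- The gap ε must not depend on n: limits do not preserve strict inequality.
_<_ : ℝ → ℝ → Set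
x < y = ∃[ ε ] (0ℚ ℚ.< ε × ∃[ M ] (∀ n → M ℕ.≤ n → ε ℚ.≤ seq y n ℚ.- seq x n))

-- The Cauchy proofs are abstract only so that comparing real numbers never
-- unfolds them; the underlying sequences compute.
private
  abstract
    const-cauchy : ∀ q → IsCauchy (λ _ → q)
    const-cauchy q ε 0<ε = 0 , λ _ _ _ _ →
      subst (ℚ._< ε) (cong ∣_∣ (sym (ℚₚ.+-inverseʳ q))) 0<ε

  half-pos : ∀ {ε} → 0ℚ ℚ.< ε → 0ℚ ℚ.< ½ ℚ.* ε
  half-pos {ε} 0<ε = subst (ℚ._< ½ ℚ.* ε) (ℚₚ.*-zeroʳ ½) (ℚₚ.*-monoʳ-<-pos ½ 0<ε)

  half+half : ∀ ε → ½ ℚ.* ε ℚ.+ ½ ℚ.* ε ≡ ε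
  half+half = solve 1 (λ e → con ½ :* e :+ con ½ :* e := e) refl
    where open +-*-Solver

  abstract
    +-cauchy : ∀ {x y} → IsCauchy x → IsCauchy y → IsCauchy (λ n → x n ℚ.+ y n)
    +-cauchy {x} {y} cx cy ε 0<ε
      with cx (½ ℚ.* ε) (half-pos 0<ε) | cy (½ ℚ.* ε) (half-pos 0<ε)
    ... | Mx , hx | My , hy = Mx ⊔ My , λ m n m≥ n≥ → begin-strict
      ∣ (x m ℚ.+ y m) ℚ.- (x n ℚ.+ y n) ∣
        ≡⟨ cong ∣_∣ (solve 4 (λ a b c d → (a :+ b) :- (c :+ d) := (a :- c) :+ (b :- d))
                          refl (x m) (y m) (x n) (y n)) ⟩
      ∣ (x m ℚ.- x n) ℚ.+ (y m ℚ.- y n) ∣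
        ≤⟨ ℚₚ.∣p+q∣≤∣p∣+∣q∣ (x m ℚ.- x n) (y m ℚ.- y n) ⟩
      ∣ x m ℚ.- x n ∣ ℚ.+ ∣ y m ℚ.- y n ∣
        <⟨ ℚₚ.+-mono-< (hx m n (ℕₚ.m⊔n≤o⇒m≤o Mx My m≥) (ℕₚ.m⊔n≤o⇒m≤o Mx My n≥))
                       (hy m n (ℕₚ.m⊔n≤o⇒n≤o Mx My m≥) (ℕₚ.m⊔n≤o⇒n≤o Mx My n≥)) ⟩
      ½ ℚ.* ε ℚ.+ ½ ℚ.* ε
        ≡⟨ half+half ε ⟩
      ε ∎
      where
      open ℚₚ.≤-Reasoning
      open +-*-Solver

  abstract
    neg-cauchy : ∀ {x} → IsCauchy x → IsCauchy (λ n → ℚ.- x n)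
    neg-cauchy {x} cx ε 0<ε with cx ε 0<ε
    ... | M , h = M , λ m n m≥ n≥ → subst (ℚ._< ε) (eq m n) (h m n m≥ n≥)
      where
      open +-*-Solver
      open ≡-Reasoning
      eq : ∀ m n → ∣ x m ℚ.- x n ∣ ≡ ∣ ℚ.- x m ℚ.- (ℚ.- x n) ∣
      eq m n = begin
        ∣ x m ℚ.- x n ∣            ≡⟨ ℚₚ.∣-p∣≡∣p∣ (x m ℚ.- x n) ⟨
        ∣ ℚ.- (x m ℚ.- x n) ∣      ≡⟨ cong ∣_∣ (solve 2 (λ a b → :- (a :- b) := :- a :- (:- b)) refl (x m) (x n)) ⟩
        ∣ ℚ.- x m ℚ.- (ℚ.- x n) ∣  ∎

  eventually-bounded : ∀ {x} → IsCauchy x →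
    ∃[ B ] (0ℚ ℚ.< B × ∃[ M ] (∀ n → M ℕ.≤ n → ∣ x n ∣ ℚ.≤ B))
  eventually-bounded {x} cx with cx 1ℚ (ℚₚ.positive⁻¹ 1ℚ)
  ... | M , h = 1ℚ ℚ.+ ∣ x M ∣
              , ℚₚ.<-≤-trans (ℚₚ.positive⁻¹ 1ℚ) 1≤
              , M , bound
    where
    open ℚₚ.≤-Reasoning
    open +-*-Solver
    1≤ : 1ℚ ℚ.≤ 1ℚ ℚ.+ ∣ x M ∣
    1≤ = subst (ℚ._≤ 1ℚ ℚ.+ ∣ x M ∣) (ℚₚ.+-identityʳ 1ℚ) (ℚₚ.+-monoʳ-≤ 1ℚ (ℚₚ.0≤∣p∣ (x M)))
    bound : ∀ n → M ℕ.≤ n → ∣ x n ∣ ℚ.≤ 1ℚ ℚ.+ ∣ x M ∣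
    bound n n≥ = begin
      ∣ x n ∣                        ≡⟨ cong ∣_∣ (solve 2 (λ a b → a := (a :- b) :+ b) refl (x n) (x M)) ⟩
      ∣ (x n ℚ.- x M) ℚ.+ x M ∣      ≤⟨ ℚₚ.∣p+q∣≤∣p∣+∣q∣ (x n ℚ.- x M) (x M) ⟩
      ∣ x n ℚ.- x M ∣ ℚ.+ ∣ x M ∣    ≤⟨ ℚₚ.+-monoˡ-≤ ∣ x M ∣ (ℚₚ.<⇒≤ (h n M n≥ ℕₚ.≤-refl)) ⟩
      1ℚ ℚ.+ ∣ x M ∣                 ∎

  ∣p∣*∣q∣-bound : ∀ p q {B δ} → 0ℚ ℚ.< B → ∣ p ∣ ℚ.≤ B → ∣ q ∣ ℚ.< δ → ∣ p ℚ.* q ∣ ℚ.< B ℚ.* δ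
  ∣p∣*∣q∣-bound p q {B} {δ} 0<B p≤ q< = begin-strict
    ∣ p ℚ.* q ∣      ≡⟨ ℚₚ.∣p*q∣≡∣p∣*∣q∣ p q ⟩
    ∣ p ∣ ℚ.* ∣ q ∣  ≤⟨ ℚₚ.*-monoʳ-≤-nonNeg ∣ q ∣ {{ℚₚ.∣-∣-nonNeg q}} p≤ ⟩
    B ℚ.* ∣ q ∣      <⟨ ℚₚ.*-monoʳ-<-pos B {{ℚ.positive 0<B}} q< ⟩
    B ℚ.* δ          ∎
    where open ℚₚ.≤-Reasoning

  split-pos : ∀ {A B ε} → 0ℚ ℚ.< A → 0ℚ ℚ.< B → 0ℚ ℚ.< ε →
    ∃[ δ ] (0ℚ ℚ.< δ × A ℚ.* δ ℚ.+ B ℚ.* δ ≡ ε)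
  split-pos {A} {B} {ε} 0<A 0<B 0<ε =
    go (A ℚ.+ B) refl (ℚ.positive (ℚₚ.+-mono-< 0<A 0<B))
    where
    go : ∀ S → A ℚ.+ B ≡ S → ℚ.Positive S →
         ∃[ δ ] (0ℚ ℚ.< δ × A ℚ.* δ ℚ.+ B ℚ.* δ ≡ ε)
    go S A+B≡S S>0 = δ , 0<δ , Sδ≡ε
      where
      open ≡-Reasoning
      S≢0 = ℚₚ.pos⇒nonZero S {{S>0}}
      S⁻¹ = ℚ.1/_ S {{S≢0}}
      δ = S⁻¹ ℚ.* ε
      0<δ : 0ℚ ℚ.< δ
      0<δ = subst (ℚ._< δ) (ℚₚ.*-zeroʳ S⁻¹) (ℚₚ.*-monoʳ-<-pos S⁻¹ {{ℚₚ.1/pos⇒pos S {{S>0}}}} 0<ε)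
      Sδ≡ε : A ℚ.* δ ℚ.+ B ℚ.* δ ≡ ε
      Sδ≡ε = begin
        A ℚ.* δ ℚ.+ B ℚ.* δ  ≡⟨ ℚₚ.*-distribʳ-+ δ A B ⟨
        (A ℚ.+ B) ℚ.* δ      ≡⟨ cong (ℚ._* δ) A+B≡S ⟩
        S ℚ.* δ              ≡⟨ ℚₚ.*-assoc S S⁻¹ ε ⟨
        (S ℚ.* S⁻¹) ℚ.* ε    ≡⟨ cong (ℚ._* ε) (ℚₚ.*-inverseʳ S {{S≢0}}) ⟩
        1ℚ ℚ.* ε             ≡⟨ ℚₚ.*-identityˡ ε ⟩
        ε                    ∎

  product-difference : ∀ a b c d →
    a ℚ.* b ℚ.- c ℚ.* d ≡ a ℚ.* (b ℚ.- d) ℚ.+ d ℚ.* (a ℚ.- c)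
  product-difference =
    solve 4 (λ a b c d → a :* b :- c :* d := a :* (b :- d) :+ d :* (a :- c)) refl
    where open +-*-Solver

  product-bound : ∀ a b c d {A B δ} → 0ℚ ℚ.< A → 0ℚ ℚ.< B →
    ∣ a ∣ ℚ.≤ A → ∣ d ∣ ℚ.≤ B → ∣ a ℚ.- c ∣ ℚ.< δ → ∣ b ℚ.- d ∣ ℚ.< δ →
    ∣ a ℚ.* b ℚ.- c ℚ.* d ∣ ℚ.< A ℚ.* δ ℚ.+ B ℚ.* δ
  product-bound a b c d {A} {B} {δ} 0<A 0<B a≤ d≤ a-c< b-d< =
    subst (λ t → ∣ t ∣ ℚ.< A ℚ.* δ ℚ.+ B ℚ.* δ) (sym (product-difference a b c d))
      (ℚₚ.≤-<-trans {∣ p ℚ.+ q ∣} {∣ p ∣ ℚ.+ ∣ q ∣} {A ℚ.* δ ℚ.+ B ℚ.* δ}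
        (ℚₚ.∣p+q∣≤∣p∣+∣q∣ p q)
        (ℚₚ.+-mono-< {∣ p ∣} {A ℚ.* δ} {∣ q ∣} {B ℚ.* δ}
          (∣p∣*∣q∣-bound a (b ℚ.- d) 0<A a≤ b-d<)
          (∣p∣*∣q∣-bound d (a ℚ.- c) 0<B d≤ a-c<)))
    where
    p = a ℚ.* (b ℚ.- d)
    q = d ℚ.* (a ℚ.- c)

  abstract
    *-cauchy : ∀ {x y} → IsCauchy x → IsCauchy y → IsCauchy (λ n → x n ℚ.* y n)
    -- let rather than with: with-abstraction would normalise the products of rationals.
    *-cauchy {x} {y} cx cy ε 0<ε =
      let A , 0<A , Ma , ha = eventually-bounded {x} cx
          B , 0<B , Mb , hb = eventually-bounded {y} cy
          δ , 0<δ , Aδ+Bδ≡ε = split-pos {A} {B} {ε} 0<A 0<B 0<ε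
          Mx , hx = cx δ 0<δ
          My , hy = cy δ 0<δ
      in (Ma ⊔ Mb) ⊔ (Mx ⊔ My) , λ m n m≥ n≥ →
        let m≥ab = ℕₚ.m⊔n≤o⇒m≤o (Ma ⊔ Mb) (Mx ⊔ My) m≥
            n≥ab = ℕₚ.m⊔n≤o⇒m≤o (Ma ⊔ Mb) (Mx ⊔ My) n≥
            m≥xy = ℕₚ.m⊔n≤o⇒n≤o (Ma ⊔ Mb) (Mx ⊔ My) m≥
            n≥xy = ℕₚ.m⊔n≤o⇒n≤o (Ma ⊔ Mb) (Mx ⊔ My) n≥
        in subst (∣ x m ℚ.* y m ℚ.- x n ℚ.* y n ∣ ℚ.<_) Aδ+Bδ≡ε
             (product-bound (x m) (y m) (x n) (y n) {A} {B} {δ} 0<A 0<B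
               (ha m (ℕₚ.m⊔n≤o⇒m≤o Ma Mb m≥ab))
               (hb n (ℕₚ.m⊔n≤o⇒n≤o Ma Mb n≥ab))
               (hx m n (ℕₚ.m⊔n≤o⇒m≤o Mx My m≥xy) (ℕₚ.m⊔n≤o⇒m≤o Mx My n≥xy))
               (hy m n (ℕₚ.m⊔n≤o⇒n≤o Mx My m≥xy) (ℕₚ.m⊔n≤o⇒n≤o Mx My n≥xy)))

infixl 7 _*_
infixl 6 _+_ _-_
infix  8 -_

fromℚ : ℚ → ℝ
fromℚ q = mkℝ (λ _ → q) (const-cauchy q)

0ℝ 1ℝ : ℝ
0ℝ = fromℚ 0ℚ
1ℝ = fromℚ 1ℚ

_+_ _*_ : ℝ → ℝ → ℝ
x + y = mkℝ (λ n → seq x n ℚ.+ seq y n) (+-cauchy {seq x} {seq y} (cauchy x) (cauchy y))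
x * y = mkℝ (λ n → seq x n ℚ.* seq y n) (*-cauchy {seq x} {seq y} (cauchy x) (cauchy y))

-_ : ℝ → ℝ
- x = mkℝ (λ n → ℚ.- seq x n) (neg-cauchy {seq x} (cauchy x))

_-_ : ℝ → ℝ → ℝ
x - y = x + (- y)

ℝ-rawRing : RawRing 0ℓ 0ℓ
ℝ-rawRing = record
  { Carrier = ℝ ; _≈_ = _≈_ ; _+_ = _+_ ; _*_ = _*_ ; -_ = -_ ; 0# = 0ℝ ; 1# = 1ℝ }

------------------------------------------------------------------------
-- Linear algebra

module LinearAlgebra {c ℓ} (R : RawRing c ℓ) where

  private
    module R = RawRing R

  open RawMonoidDefs R.+-rawMonoid using (sum) public

  dot : ∀ {n} → Vector R.Carrier n → Vector R.Carrier n → R.Carrier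
  dot u v = sum (λ i → u i R.* v i)

  -- v₀ - (v₁ - (v₂ - ⋯)) = v₀ - v₁ + v₂ - ⋯
  alternatingSum : ∀ {n} → Vector R.Carrier n → R.Carrier
  alternatingSum {zero}  v = R.0#
  alternatingSum {suc n} v = v zero R.+ (R.- alternatingSum (v ∘ suc))

  -- Laplace expansion along the first row; A i j is the entry in row i, column j.
  det : ∀ {n} → (Fin n → Fin n → R.Carrier) → R.Carrier
  det {zero}  A = R.1#
  det {suc n} A =
    alternatingSum (λ j → A zero j R.* det (λ r c → A (suc r) (punchIn j c)))

open LinearAlgebra ℝ-rawRing public

------------------------------------------------------------------------
-- Point sequences and their order types

Point : ℕ → Set
Point d = Vector ℝ d

Points : ℕ → ℕ → Set
Points d N = Vector (Point d) N

StrictlyIncreasing : ∀ {k N} → (Fin k → Fin N) → Set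
StrictlyIncreasing ι = ι Preserves Fin._<_ ⟶ Fin._<_

record Hyperplane (d : ℕ) : Set where
  field
    normal   : Point d
    offset   : ℝ
    normal≉0 : ¬ (∀ i → normal i ≈ 0ℝ)

_liesOn_ : ∀ {d} → Point d → Hyperplane d → Set
p liesOn H = dot normal p ≈ offset
  where open Hyperplane H

record GeneralPosition {d N} (P : Points d N) : Set where
  field
    noCommonHyperplane : (ι : Fin (suc d) → Fin N) → StrictlyIncreasing ι →
                         ¬ (Σ (Hyperplane d) λ H → ∀ k → P (ι k) liesOn H)
    distinctCoordinates : ∀ (i : Fin d) (a b : Fin N) → a ≢ b → ¬ (P a i ≈ P b i)

-- The columns are the differences of the later points with the first one.
differences : ∀ {d} → Points d (suc d) → Fin d → Fin d → ℝ
differences p i j = p (suc j) i - p zero i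

HasOrientation : ∀ {d} → Points d (suc d) → Sign → Set
HasOrientation p Sign.+ = 0ℝ < det (differences p)
HasOrientation p Sign.- = det (differences p) < 0ℝ

Homogeneous : ∀ {d n} → Points d n → Set
Homogeneous {d} {n} P = ∃[ s ] ((ι : Fin (suc d) → Fin n) → StrictlyIncreasing ι →
                                HasOrientation (P ∘ ι) s)

HomogeneousUnavoidable : (d n N : ℕ) → Set
HomogeneousUnavoidable d n N =
  (P : Points d N) → GeneralPosition P →
  Σ (Fin n → Fin N) λ σ → StrictlyIncreasing σ × Homogeneous (P ∘ σ)

-- OT_d(n) = N, given as a relation because a smallest N need not exist a priori.
IsOT : (d n N : ℕ) → Set
IsOT d n N = HomogeneousUnavoidable d n N ×
             (∀ M → HomogeneousUnavoidable d n M → N ℕ.≤ M)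

-- The tower function is defined for index k ≥ 1; the value at 0 is arbitrary.
twr : ℕ → ℕ → ℕ
twr 0             x = 0
twr 1             x = x
twr (suc (suc k)) x = 2 ^ twr (suc k) x

{-# OPTIONS --safe #-}
-- An Erdős–Rado greedy selection makes the orientation of a (d+1)-tuple depend only on its
-- first d members; the last point chosen then stands for the last member.  Iterating this down
-- to triples costs one exponential per step, and the polynomial losses are absorbed by the tower.
-- For triples, the orientation is a bracket [a b c] = det (a, b, c, W) with W fixed, which obeys
-- the three-term Plücker relations.  With one point o of the sequence as point at infinity, these
-- relations make the colour of pairs sign [o x y] transitive (after a pigeonhole step), and then
-- the colour of triples sign [a b c] transitive, so that the theorems of Erdős and Szekeres on
-- monotone subsequences and on cups and caps give a homogeneous subsequence of n points
-- out of 2^O(n): this saves one exponential over Ramsey's theorem.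
module Submission where

open import Algebra.Bundles using (CommutativeRing)
import Algebra.Properties.Ring
import Algebra.Properties.Semiring.Exp
import Algebra.Properties.Semiring.Sum
open import Axiom.ExcludedMiddle using (ExcludedMiddle)
open import Data.Fin.Base as Fin using (Fin; zero; suc; inject₁; inject≤; punchIn; punchOut; toℕ; fromℕ<)
open import Data.Fin.Induction using (<-weakInduction)
import Data.Fin.Properties as Finₚ
open import Data.List.Base as List using (List; []; _∷_; length; filter; map; take; reverse; allFin; cartesianProductWith)
open import Data.List.Membership.Propositional using (_∈_)
open import Data.List.Membership.Propositional.Properties using (∈-filter⁻; ∈-cartesianProductWith⁺; ∈-map⁺; ∈-lookup)
import Data.List.Properties as Listₚ
open import Data.List.Relation.Unary.All as All using (All; []; _∷_)
import Data.List.Relation.Unary.All.Properties as Allₚ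
open import Data.List.Relation.Unary.AllPairs as AllPairs using (AllPairs; []; _∷_)
import Data.List.Relation.Unary.AllPairs.Properties as AllPairsₚ
open import Data.List.Relation.Unary.Any using (here; there)
import Data.List.Relation.Unary.Any.Properties as Anyₚ
open import Data.Nat.Base as ℕ using (ℕ; zero; suc; z≤n; s≤s)
open import Data.Nat.Induction using (<-rec)
import Data.Nat.Properties as ℕₚ
import Data.Nat.Solver
open import Data.Product.Base as Product using (Σ; _×_; _,_; ∃-syntax; proj₁; proj₂)
open import Data.Rational.Base as ℚ using (ℚ; 0ℚ; 1ℚ; ½; ∣_∣)
import Data.Rational.Properties as ℚₚ
import Data.Rational.Solver
open import Data.Sign.Base as Sign using (Sign)
import Data.Sign.Properties as Signₚ
open import Data.Sum.Base using (_⊎_; inj₁; inj₂; [_,_]′)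
open import Data.Unit.Base using (⊤; tt)
open import Data.Vec.Base as Vec using (Vec; []; _∷_; _∷ʳ_; lookup; tabulate)
open import Data.Vec.Functional using (Vector; updateAt)
open import Data.Vec.Functional.Properties using (updateAt-updates; updateAt-minimal)
import Data.Vec.Properties as Vecₚ
open import Data.Vec.Relation.Unary.All as VecAll using ([]; _∷_) renaming (All to VecAll)
import Data.Vec.Relation.Unary.All.Properties as VecAllₚ
open import Data.Vec.Relation.Unary.AllPairs using ([]; _∷_) renaming (AllPairs to VecAllPairs)
open import Function.Base using (_∘_; const; flip; id)
open import Level using (0ℓ)
open import Relation.Binary.Core using (Rel; _Preserves_⟶_)
open import Relation.Binary.Definitions using (Transitive; tri<; tri≈; tri>)
open import Relation.Binary.PropositionalEquality as ≡ using (_≡_; _≢_)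
import Relation.Binary.Reasoning.Setoid
open import Relation.Nullary using (¬_; Dec; yes; no; contradiction; ¬?)
open import Relation.Unary using (Decidable)
import Defs
open Defs using (IsOT; twr)

-- The real numbers as an ordered ring

-- The orientation of `d + 1` points is the determinant of the vectors `(1, p)`. In these
-- homogeneous coordinates all members of a tuple are columns of equal standing, so some can be
-- frozen as `W`. With `d = 2 + k`, the reduction freezes `k` columns. Their points come after all
-- remaining ones, so `a b c W` is again an increasing tuple, and by general position its bracket
-- does not vanish.
--
-- The obstacle is that brackets see vectors only modulo the span of `W`. These images need not lie
-- in a common affine chart, nor have an abscissa that increases along the sequence, while cups and
-- caps rely on both. The point `o` supplies a substitute: once `[o x y]` has constant sign, the
-- index order plays the role of the abscissa order. A Plücker relation then reads `p x = q y + r z`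
-- with `p`, `q`, `r` of one sign, which forces on `x` the common sign of `y` and `z`: this is
-- transitivity.
--
-- Sorting around `o` costs a square and a factor two, hence only a constant in the exponent. The
-- planar stage therefore needs `twr 2 (O(n))` points, and `k` exponentials on top of it give height
-- `2 + k = d`.

module RealRing where

  open ≡ using (refl; sym; trans; cong; subst; module ≡-Reasoning)
  open Data.Rational.Solver using (module +-*-Solver)
  open import Data.Nat.Base using (_⊔_)
  open Defs using (ℝ; seq; cauchy; IsCauchy; _≈_; _<_; _+_; _*_; -_; 0ℝ; 1ℝ)

  -- Null sequences and the ring laws

  Null : (ℕ → ℚ) → Set
  Null z = ∀ ε → 0ℚ ℚ.< ε → ∃[ M ] (∀ n → M ℕ.≤ n → ∣ z n ∣ ℚ.< ε)

  Null-resp : ∀ {z z′} → (∀ n → z n ≡ z′ n) → Null z → Null z′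
  Null-resp z≗z′ z→0 ε 0<ε =
    let M , h = z→0 ε 0<ε in M , λ n n≥ → subst (λ t → ∣ t ∣ ℚ.< ε) (z≗z′ n) (h n n≥)

  Null-0 : Null (λ _ → 0ℚ)
  Null-0 ε 0<ε = 0 , λ _ _ → 0<ε

  half-positive : ∀ {ε} → 0ℚ ℚ.< ε → 0ℚ ℚ.< ½ ℚ.* ε
  half-positive {ε} 0<ε = subst (ℚ._< ½ ℚ.* ε) (ℚₚ.*-zeroʳ ½) (ℚₚ.*-monoʳ-<-pos ½ 0<ε)

  halves : ∀ ε → ½ ℚ.* ε ℚ.+ ½ ℚ.* ε ≡ ε
  halves = solve 1 (λ e → con ½ :* e :+ con ½ :* e := e) refl
    where open +-*-Solver

  Null-+ : ∀ {y z} → Null y → Null z → Null (λ n → y n ℚ.+ z n)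
  Null-+ {y} {z} y→0 z→0 ε 0<ε =
    let M , h = y→0 (½ ℚ.* ε) (half-positive 0<ε)
        L , k = z→0 (½ ℚ.* ε) (half-positive 0<ε)
    in M ⊔ L , λ n n≥ → subst (∣ y n ℚ.+ z n ∣ ℚ.<_) (halves ε)
         (ℚₚ.≤-<-trans (ℚₚ.∣p+q∣≤∣p∣+∣q∣ (y n) (z n))
           (ℚₚ.+-mono-< (h n (ℕₚ.m⊔n≤o⇒m≤o M L n≥)) (k n (ℕₚ.m⊔n≤o⇒n≤o M L n≥))))

  Null-neg : ∀ {z} → Null z → Null (λ n → ℚ.- z n)
  Null-neg {z} z→0 ε 0<ε =
    let M , h = z→0 ε 0<ε
    in M , λ n n≥ → subst (ℚ._< ε) (sym (ℚₚ.∣-p∣≡∣p∣ (z n))) (h n n≥)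

  Cauchy⇒bounded : ∀ {x} → IsCauchy x →
    ∃[ B ] (0ℚ ℚ.< B × ∃[ M ] (∀ n → M ℕ.≤ n → ∣ x n ∣ ℚ.≤ B))
  Cauchy⇒bounded {x} cx =
    let M , h = cx 1ℚ (ℚₚ.positive⁻¹ 1ℚ)
    in 1ℚ ℚ.+ ∣ x M ∣
     , ℚₚ.+-mono-<-≤ (ℚₚ.positive⁻¹ 1ℚ) (ℚₚ.0≤∣p∣ (x M))
     , M , λ n n≥ → begin
        ∣ x n ∣                      ≡⟨ cong ∣_∣ (solve 2 (λ a b → a := (a :- b) :+ b) refl (x n) (x M)) ⟩
        ∣ (x n ℚ.- x M) ℚ.+ x M ∣    ≤⟨ ℚₚ.∣p+q∣≤∣p∣+∣q∣ (x n ℚ.- x M) (x M) ⟩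
        ∣ x n ℚ.- x M ∣ ℚ.+ ∣ x M ∣  ≤⟨ ℚₚ.+-monoˡ-≤ ∣ x M ∣ (ℚₚ.<⇒≤ (h n M n≥ ℕₚ.≤-refl)) ⟩
        1ℚ ℚ.+ ∣ x M ∣               ∎
    where
    open ℚₚ.≤-Reasoning
    open +-*-Solver

  ∣p*q∣<Bδ : ∀ p q {B δ} → 0ℚ ℚ.< B → ∣ p ∣ ℚ.≤ B → ∣ q ∣ ℚ.< δ → ∣ p ℚ.* q ∣ ℚ.< B ℚ.* δ
  ∣p*q∣<Bδ p q {B} {δ} 0<B p≤B q<δ = begin-strict
    ∣ p ℚ.* q ∣      ≡⟨ ℚₚ.∣p*q∣≡∣p∣*∣q∣ p q ⟩
    ∣ p ∣ ℚ.* ∣ q ∣  ≤⟨ ℚₚ.*-monoʳ-≤-nonNeg ∣ q ∣ {{ℚₚ.∣-∣-nonNeg q}} p≤B ⟩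
    B ℚ.* ∣ q ∣      <⟨ ℚₚ.*-monoʳ-<-pos B {{ℚ.positive 0<B}} q<δ ⟩
    B ℚ.* δ          ∎
    where open ℚₚ.≤-Reasoning

  0<p*q : ∀ p q → 0ℚ ℚ.< p → 0ℚ ℚ.< q → 0ℚ ℚ.< p ℚ.* q
  0<p*q p q 0<p 0<q =
    subst (ℚ._< p ℚ.* q) (ℚₚ.*-zeroʳ p) (ℚₚ.*-monoʳ-<-pos p {{ℚ.positive 0<p}} 0<q)

  divide : ∀ B ε → 0ℚ ℚ.< B → 0ℚ ℚ.< ε → ∃[ δ ] (0ℚ ℚ.< δ × B ℚ.* δ ≡ ε)
  divide B ε 0<B 0<ε = B⁻¹ ℚ.* ε , 0<p*q B⁻¹ ε 0<B⁻¹ 0<ε , (begin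
    B ℚ.* (B⁻¹ ℚ.* ε)  ≡⟨ ℚₚ.*-assoc B B⁻¹ ε ⟨
    (B ℚ.* B⁻¹) ℚ.* ε  ≡⟨ cong (ℚ._* ε) (ℚₚ.*-inverseʳ B {{B≢0}}) ⟩
    1ℚ ℚ.* ε           ≡⟨ ℚₚ.*-identityˡ ε ⟩
    ε                  ∎)
    where
    open ≡-Reasoning
    B≢0 = ℚₚ.pos⇒nonZero B {{ℚ.positive 0<B}}
    B⁻¹ = ℚ.1/_ B {{B≢0}}
    0<B⁻¹ = ℚₚ.positive⁻¹ B⁻¹ {{ℚₚ.1/pos⇒pos B {{ℚ.positive 0<B}}}}

  Null-* : ∀ {x z} → IsCauchy x → Null z → Null (λ n → x n ℚ.* z n)
  Null-* {x} {z} cx z→0 ε 0<ε =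
    let B , 0<B , M , bound = Cauchy⇒bounded {x} cx
        δ , 0<δ , Bδ≡ε = divide B ε 0<B 0<ε
        L , small = z→0 δ 0<δ
    in M ⊔ L , λ n n≥ → subst (∣ x n ℚ.* z n ∣ ℚ.<_) Bδ≡ε
         (∣p*q∣<Bδ (x n) (z n) 0<B (bound n (ℕₚ.m⊔n≤o⇒m≤o M L n≥)) (small n (ℕₚ.m⊔n≤o⇒n≤o M L n≥)))

  ≗⇒≈ : ∀ {x y} → (∀ n → seq x n ≡ seq y n) → x ≈ y
  ≗⇒≈ {x} {y} x≗y = Null-resp (λ n → sym (trans (cong (ℚ._- seq y n) (x≗y n)) (ℚₚ.+-inverseʳ (seq y n)))) Null-0

  ≈-refl : ∀ {x} → x ≈ x
  ≈-refl {x} = ≗⇒≈ {x} {x} λ _ → refl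

  ≈-sym : ∀ {x y} → x ≈ y → y ≈ x
  ≈-sym {x} {y} x≈y = Null-resp (λ n → lemma (seq x n) (seq y n)) (Null-neg x≈y)
    where
    open +-*-Solver
    lemma : ∀ a b → ℚ.- (a ℚ.- b) ≡ b ℚ.- a
    lemma = solve 2 (λ a b → :- (a :- b) := b :- a) refl

  ≈-trans : ∀ {x y z} → x ≈ y → y ≈ z → x ≈ z
  ≈-trans {x} {y} {z} x≈y y≈z = Null-resp (λ n → lemma (seq x n) (seq y n) (seq z n)) (Null-+ x≈y y≈z)
    where
    open +-*-Solver
    lemma : ∀ a b c → (a ℚ.- b) ℚ.+ (b ℚ.- c) ≡ a ℚ.- c
    lemma = solve 3 (λ a b c → (a :- b) :+ (b :- c) := a :- c) refl

  +-cong : ∀ {x y u v} → x ≈ y → u ≈ v → x + u ≈ y + v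
  +-cong {x} {y} {u} {v} x≈y u≈v =
    Null-resp (λ n → lemma (seq x n) (seq y n) (seq u n) (seq v n)) (Null-+ x≈y u≈v)
    where
    open +-*-Solver
    lemma : ∀ a b c d → (a ℚ.- b) ℚ.+ (c ℚ.- d) ≡ (a ℚ.+ c) ℚ.- (b ℚ.+ d)
    lemma = solve 4 (λ a b c d → (a :- b) :+ (c :- d) := (a :+ c) :- (b :+ d)) refl

  neg-cong : ∀ {x y} → x ≈ y → - x ≈ - y
  neg-cong {x} {y} x≈y = Null-resp (λ n → lemma (seq x n) (seq y n)) (Null-neg x≈y)
    where
    open +-*-Solver
    lemma : ∀ a b → ℚ.- (a ℚ.- b) ≡ ℚ.- a ℚ.- (ℚ.- b)
    lemma = solve 2 (λ a b → :- (a :- b) := :- a :- (:- b)) refl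

  *-cong : ∀ {x y u v} → x ≈ y → u ≈ v → x * u ≈ y * v
  *-cong {x} {y} {u} {v} x≈y u≈v =
    Null-resp (λ n → lemma (seq x n) (seq y n) (seq u n) (seq v n))
      (Null-+ (Null-* {seq x} (cauchy x) u≈v) (Null-* {seq v} (cauchy v) x≈y))
    where
    open +-*-Solver
    lemma : ∀ a b c d → a ℚ.* (c ℚ.- d) ℚ.+ d ℚ.* (a ℚ.- b) ≡ a ℚ.* c ℚ.- b ℚ.* d
    lemma = solve 4 (λ a b c d → a :* (c :- d) :+ d :* (a :- b) := a :* c :- b :* d) refl

  ℝ-commutativeRing : CommutativeRing 0ℓ 0ℓ
  ℝ-commutativeRing = record
    { Carrier = ℝ ; _≈_ = _≈_ ; _+_ = _+_ ; _*_ = _*_ ; -_ = -_ ; 0# = 0ℝ ; 1# = 1ℝ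
    ; isCommutativeRing = record
      { isRing = record
        { +-isAbelianGroup = record
          { isGroup = record
            { isMonoid = record
              { isSemigroup = record
                { isMagma = record
                  { isEquivalence = record
                    { refl = λ {x} → ≈-refl {x}
                    ; sym = λ {x} {y} → ≈-sym {x} {y}
                    ; trans = λ {x} {y} {z} → ≈-trans {x} {y} {z} }
                  ; ∙-cong = λ {x} {y} {u} {v} → +-cong {x} {y} {u} {v} }
                ; assoc = λ x y z → ≗⇒≈ {(x + y) + z} {x + (y + z)} λ n → ℚₚ.+-assoc (seq x n) (seq y n) (seq z n) }
              ; identity = (λ x → ≗⇒≈ {0ℝ + x} {x} λ n → ℚₚ.+-identityˡ (seq x n))
                         , (λ x → ≗⇒≈ {x + 0ℝ} {x} λ n → ℚₚ.+-identityʳ (seq x n)) }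
            ; inverse = (λ x → ≗⇒≈ {(- x) + x} {0ℝ} λ n → ℚₚ.+-inverseˡ (seq x n))
                      , (λ x → ≗⇒≈ {x + (- x)} {0ℝ} λ n → ℚₚ.+-inverseʳ (seq x n))
            ; ⁻¹-cong = λ {x} {y} → neg-cong {x} {y} }
          ; comm = λ x y → ≗⇒≈ {x + y} {y + x} λ n → ℚₚ.+-comm (seq x n) (seq y n) }
        ; *-cong = λ {x} {y} {u} {v} → *-cong {x} {y} {u} {v}
        ; *-assoc = λ x y z → ≗⇒≈ {(x * y) * z} {x * (y * z)} λ n → ℚₚ.*-assoc (seq x n) (seq y n) (seq z n)
        ; *-identity = (λ x → ≗⇒≈ {1ℝ * x} {x} λ n → ℚₚ.*-identityˡ (seq x n))
                     , (λ x → ≗⇒≈ {x * 1ℝ} {x} λ n → ℚₚ.*-identityʳ (seq x n))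
        ; distrib = (λ x y z → ≗⇒≈ {x * (y + z)} {x * y + x * z} λ n → ℚₚ.*-distribˡ-+ (seq x n) (seq y n) (seq z n))
                  , (λ x y z → ≗⇒≈ {(y + z) * x} {y * x + z * x} λ n → ℚₚ.*-distribʳ-+ (seq x n) (seq y n) (seq z n)) }
      ; *-comm = λ x y → ≗⇒≈ {x * y} {y * x} λ n → ℚₚ.*-comm (seq x n) (seq y n) } }

  -- Positivity and trichotomy

  0<⇒eventually : ∀ {x} → 0ℝ < x → ∃[ ε ] (0ℚ ℚ.< ε × ∃[ M ] (∀ n → M ℕ.≤ n → ε ℚ.≤ seq x n))
  0<⇒eventually {x} (ε , 0<ε , M , h) =
    ε , 0<ε , M , λ n n≥ → subst (ε ℚ.≤_) (ℚₚ.+-identityʳ (seq x n)) (h n n≥)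

  eventually⇒0< : ∀ {x} ε → 0ℚ ℚ.< ε → ∀ M → (∀ n → M ℕ.≤ n → ε ℚ.≤ seq x n) → 0ℝ < x
  eventually⇒0< {x} ε 0<ε M h =
    ε , 0<ε , M , λ n n≥ → subst (ε ℚ.≤_) (sym (ℚₚ.+-identityʳ (seq x n))) (h n n≥)

  0<-+ : ∀ {x y} → 0ℝ < x → 0ℝ < y → 0ℝ < x + y
  0<-+ {x} {y} 0<x 0<y =
    let ε , 0<ε , M , h = 0<⇒eventually {x} 0<x
        δ , 0<δ , L , k = 0<⇒eventually {y} 0<y
    in eventually⇒0< {x + y} (ε ℚ.+ δ) (ℚₚ.+-mono-< 0<ε 0<δ) (M ⊔ L) λ n n≥ →
         ℚₚ.+-mono-≤ (h n (ℕₚ.m⊔n≤o⇒m≤o M L n≥)) (k n (ℕₚ.m⊔n≤o⇒n≤o M L n≥))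

  *-mono-≤-pos : ∀ {p q r s} → 0ℚ ℚ.< p → 0ℚ ℚ.< r → p ℚ.≤ q → r ℚ.≤ s → p ℚ.* r ℚ.≤ q ℚ.* s
  *-mono-≤-pos {p} {q} {r} {s} 0<p 0<r p≤q r≤s = ℚₚ.≤-trans
    (ℚₚ.*-monoˡ-≤-nonNeg p {{ℚ.nonNegative (ℚₚ.<⇒≤ 0<p)}} r≤s)
    (ℚₚ.*-monoʳ-≤-nonNeg s {{ℚ.nonNegative (ℚₚ.≤-trans (ℚₚ.<⇒≤ 0<r) r≤s)}} p≤q)

  0<-* : ∀ {x y} → 0ℝ < x → 0ℝ < y → 0ℝ < x * y
  0<-* {x} {y} 0<x 0<y =
    let ε , 0<ε , M , h = 0<⇒eventually {x} 0<x
        δ , 0<δ , L , k = 0<⇒eventually {y} 0<y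
    in eventually⇒0< {x * y} (ε ℚ.* δ) (0<p*q ε δ 0<ε 0<δ) (M ⊔ L) λ n n≥ →
         *-mono-≤-pos 0<ε 0<δ (h n (ℕₚ.m⊔n≤o⇒m≤o M L n≥)) (k n (ℕₚ.m⊔n≤o⇒n≤o M L n≥))

  -- Half of the gap `ε` survives a perturbation smaller than the other half. It serves both for
  -- equivalent sequences and for two late terms of one Cauchy sequence.
  stays-positive : ∀ a b ε → ε ℚ.≤ a → ∣ a ℚ.- b ∣ ℚ.< ½ ℚ.* ε → ½ ℚ.* ε ℚ.≤ b
  stays-positive a b ε ε≤a close = begin
    ½ ℚ.* ε          ≡⟨ solve 1 (λ e → con ½ :* e := e :- con ½ :* e) refl ε ⟩
    ε ℚ.- ½ ℚ.* ε    ≤⟨ ℚₚ.+-mono-≤ ε≤a (ℚₚ.neg-antimono-≤ (ℚₚ.≤-trans (p≤∣p∣ (a ℚ.- b)) (ℚₚ.<⇒≤ close))) ⟩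
    a ℚ.- (a ℚ.- b)  ≡⟨ solve 2 (λ a b → a :- (a :- b) := b) refl a b ⟩
    b                ∎
    where
    open ℚₚ.≤-Reasoning
    open +-*-Solver
    p≤∣p∣ : ∀ p → p ℚ.≤ ∣ p ∣
    p≤∣p∣ p with ℚₚ.≤-total 0ℚ p
    ... | inj₁ 0≤p = ℚₚ.≤-reflexive (sym (ℚₚ.0≤p⇒∣p∣≡p 0≤p))
    ... | inj₂ p≤0 = ℚₚ.≤-trans p≤0 (ℚₚ.0≤∣p∣ p)

  0<-resp-≈ : ∀ {x y} → x ≈ y → 0ℝ < x → 0ℝ < y
  0<-resp-≈ {x} {y} x≈y 0<x =
    let ε , 0<ε , M , h = 0<⇒eventually {x} 0<x
        L , k = x≈y (½ ℚ.* ε) (half-positive 0<ε)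
    in eventually⇒0< {y} (½ ℚ.* ε) (half-positive 0<ε) (M ⊔ L) λ n n≥ →
         stays-positive (seq x n) (seq y n) ε (h n (ℕₚ.m⊔n≤o⇒m≤o M L n≥)) (k n (ℕₚ.m⊔n≤o⇒n≤o M L n≥))

  0≮0 : ¬ (0ℝ < 0ℝ)
  0≮0 0<0 =
    let ε , 0<ε , M , h = 0<⇒eventually {0ℝ} 0<0
    in ℚₚ.<-irrefl refl (ℚₚ.<-≤-trans 0<ε (h M ℕₚ.≤-refl))

  0<1 : 0ℝ < 1ℝ
  0<1 = eventually⇒0< {1ℝ} 1ℚ (ℚₚ.positive⁻¹ 1ℚ) 0 λ _ _ → ℚₚ.≤-refl

  0<-⇒negative : ∀ {x} → 0ℝ < - x → x < 0ℝ
  0<-⇒negative {x} (ε , 0<ε , M , h) =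
    ε , 0<ε , M , λ n n≥ → subst (ε ℚ.≤_) (ℚₚ.+-comm (ℚ.- seq x n) 0ℚ) (h n n≥)

  module _ (em : ExcludedMiddle 0ℓ) where

    -- If neither strict sign holds, late terms are small: a late term of absolute value at least
    -- `ε` would, by the Cauchy property, keep all later terms at distance at least `½ ε` from zero
    -- on its own side, which is a strict sign.
    trichotomy : ∀ x → x ≈ 0ℝ ⊎ 0ℝ < x ⊎ 0ℝ < - x
    trichotomy x with em {0ℝ < x} | em {0ℝ < - x}
    ... | yes 0<x | _        = inj₂ (inj₁ 0<x)
    ... | no _    | yes 0<-x = inj₂ (inj₂ 0<-x)
    ... | no 0≮x  | no 0≮-x  = inj₁ λ ε 0<ε →
      let M , h = cauchy x (½ ℚ.* ε) (half-positive 0<ε)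
      in M , λ n n≥ → subst (λ t → ∣ t ∣ ℚ.< ε) (sym (ℚₚ.+-identityʳ (seq x n)))
           (ℚₚ.≰⇒> (large-absurd ε 0<ε M h n n≥))
      where
      open +-*-Solver
      large-absurd : ∀ ε → 0ℚ ℚ.< ε → ∀ M →
        (∀ m n → M ℕ.≤ m → M ℕ.≤ n → ∣ seq x m ℚ.- seq x n ∣ ℚ.< ½ ℚ.* ε) →
        ∀ n → M ℕ.≤ n → ¬ (ε ℚ.≤ ∣ seq x n ∣)
      large-absurd ε 0<ε M h n n≥ ε≤ with ℚₚ.∣p∣≡p∨∣p∣≡-p (seq x n)
      ... | inj₁ ∣x∣≡x = 0≮x (eventually⇒0< {x} (½ ℚ.* ε) (half-positive 0<ε) M λ m m≥ →
              stays-positive (seq x n) (seq x m) ε (subst (ε ℚ.≤_) ∣x∣≡x ε≤) (h n m n≥ m≥))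
      ... | inj₂ ∣x∣≡-x = 0≮-x (eventually⇒0< { - x} (½ ℚ.* ε) (half-positive 0<ε) M λ m m≥ →
              stays-positive (ℚ.- seq x n) (ℚ.- seq x m) ε (subst (ε ℚ.≤_) ∣x∣≡-x ε≤)
                (subst (λ t → ∣ t ∣ ℚ.< ½ ℚ.* ε)
                  (solve 2 (λ a b → b :- a := :- a :- (:- b)) refl (seq x n) (seq x m)) (h m n m≥ n≥)))

-- Determinants

module Determinants (R : CommutativeRing 0ℓ 0ℓ) where

  open CommutativeRing R hiding (zero)
  open Algebra.Properties.Ring ring
  open Algebra.Properties.Semiring.Sum semiring
    using (sum-cong-≋; ∑-distrib-+; *-distribˡ-sum; sum-replicate-zero)
  open Algebra.Properties.Semiring.Exp semiring using (_^_)
  open Defs.LinearAlgebra rawRing using (det; alternatingSum; dot)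
  open Relation.Binary.Reasoning.Setoid setoid

  Matrix : ℕ → Set
  Matrix n = Fin n → Vector Carrier n

  minor : ∀ {n} → Matrix (suc n) → Fin (suc n) → Matrix n
  minor A k r c = A (suc r) (punchIn k c)

  dot-cong : ∀ {n} {a b u v : Vector Carrier n} →
             (∀ i → a i ≈ b i) → (∀ i → u i ≈ v i) → dot a u ≈ dot b v
  dot-cong a≈b u≈v = sum-cong-≋ λ i → *-cong (a≈b i) (u≈v i)

  dot-0ˡ : ∀ {n} (u : Vector Carrier n) → dot (const 0#) u ≈ 0#
  dot-0ˡ {n} u = trans (sum-cong-≋ λ i → zeroˡ (u i)) (sum-replicate-zero n)

  dot-+ˡ : ∀ {n} (a b u : Vector Carrier n) → dot (λ i → a i + b i) u ≈ dot a u + dot b u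
  dot-+ˡ a b u = trans (sum-cong-≋ λ i → distribʳ (u i) (a i) (b i))
                       (∑-distrib-+ (λ i → a i * u i) (λ i → b i * u i))

  dot-*ˡ : ∀ {n} c (a u : Vector Carrier n) → dot (λ i → c * a i) u ≈ c * dot a u
  dot-*ˡ c a u = trans (sum-cong-≋ λ i → *-assoc c (a i) (u i))
                       (sym (*-distribˡ-sum c λ i → a i * u i))

  dot-comm : ∀ {n} (a u : Vector Carrier n) → dot a u ≈ dot u a
  dot-comm a u = sum-cong-≋ λ i → *-comm (a i) (u i)

  dot-+ʳ : ∀ {n} (a u v : Vector Carrier n) → dot a (λ i → u i + v i) ≈ dot a u + dot a v
  dot-+ʳ a u v = trans (dot-comm a _) (trans (dot-+ˡ u v a) (+-cong (dot-comm u a) (dot-comm v a)))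

  dot-*ʳ : ∀ {n} c (a u : Vector Carrier n) → dot a (λ i → c * u i) ≈ c * dot a u
  dot-*ʳ c a u = trans (dot-comm a _) (trans (dot-*ˡ c u a) (*-congˡ (dot-comm u a)))

  dot-difference : ∀ {n} (a u v : Vector Carrier n) → dot a (λ i → u i - v i) ≈ dot a u - dot a v
  dot-difference a u v = begin
    dot a (λ i → u i - v i)                ≈⟨ dot-+ʳ a u (λ i → - v i) ⟩
    dot a u + dot a (λ i → - v i)          ≈⟨ +-congˡ (dot-cong {a = a} (λ _ → refl) (λ i → sym (-1*x≈-x (v i)))) ⟩
    dot a u + dot a (λ i → - 1# * v i)     ≈⟨ +-congˡ (dot-*ʳ (- 1#) a v) ⟩
    dot a u + - 1# * dot a v               ≈⟨ +-congˡ (-1*x≈-x (dot a v)) ⟩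
    dot a u - dot a v                      ∎

  -- Linearity is witnessed by a coefficient vector, so that a functional vanishing on the columns
  -- of a regular matrix is killed by `regular⇒kernel-trivial`.
  Linear : ∀ {n} → (Vector Carrier n → Carrier) → Set
  Linear F = ∃[ a ] (∀ u → F u ≈ dot a u)

  linear-resp : ∀ {n} {F G : Vector Carrier n → Carrier} → (∀ u → F u ≈ G u) → Linear G → Linear F
  linear-resp F≈G (a , G≈a) = a , λ u → trans (F≈G u) (G≈a u)

  linear-0 : ∀ {n} → Linear {n} (const 0#)
  linear-0 = const 0# , λ u → sym (dot-0ˡ u)

  linear-+ : ∀ {n} {F G : Vector Carrier n → Carrier} → Linear F → Linear G → Linear (λ u → F u + G u)
  linear-+ (a , F≈a) (b , G≈b) =
    (λ i → a i + b i) , λ u → trans (+-cong (F≈a u) (G≈b u)) (sym (dot-+ˡ a b u))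

  linear-* : ∀ {n} c {F : Vector Carrier n → Carrier} → Linear F → Linear (λ u → c * F u)
  linear-* c (a , F≈a) = (λ i → c * a i) , λ u → trans (*-congˡ (F≈a u)) (sym (dot-*ˡ c a u))

  linear-neg : ∀ {n} {F : Vector Carrier n → Carrier} → Linear F → Linear (λ u → - F u)
  linear-neg {F = F} lin = linear-resp (λ u → sym (-1*x≈-x (F u))) (linear-* (- 1#) lin)

  linear-head : ∀ {n} c → Linear {suc n} (λ u → u zero * c)
  linear-head c = (λ { zero → c ; (suc _) → 0# }) , λ u →
    trans (*-comm (u zero) c) (trans (sym (+-identityʳ _)) (+-congˡ (sym (dot-0ˡ (u ∘ suc)))))

  linear-tail : ∀ {n} {F : Vector Carrier n → Carrier} → Linear F → Linear (λ u → F (u ∘ suc))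
  linear-tail (a , F≈a) = (λ { zero → 0# ; (suc i) → a i }) , λ u →
    trans (F≈a (u ∘ suc)) (trans (sym (+-identityˡ _)) (+-congʳ (sym (zeroˡ (u zero)))))

  linear-alternatingSum : ∀ {m n} {F : Fin m → Vector Carrier n → Carrier} →
    (∀ k → Linear (F k)) → Linear (λ u → alternatingSum (λ k → F k u))
  linear-alternatingSum {zero}  lin = linear-0
  linear-alternatingSum {suc m} lin =
    linear-+ (lin zero) (linear-neg (linear-alternatingSum (lin ∘ suc)))

  linear-combination : ∀ {n} {F : Vector Carrier n → Carrier} → Linear F → ∀ c d u v →
    F (λ i → c * u i + d * v i) ≈ c * F u + d * F v
  linear-combination {F = F} (a , F≈a) c d u v = begin
    F (λ i → c * u i + d * v i)      ≈⟨ F≈a _ ⟩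
    dot a (λ i → c * u i + d * v i)  ≈⟨ dot-+ʳ a (λ i → c * u i) (λ i → d * v i) ⟩
    dot a (λ i → c * u i) + dot a (λ i → d * v i)  ≈⟨ +-cong (dot-*ʳ c a u) (dot-*ʳ d a v) ⟩
    c * dot a u + d * dot a v        ≈⟨ +-cong (*-congˡ (F≈a u)) (*-congˡ (F≈a v)) ⟨
    c * F u + d * F v                ∎

  alternatingSum-cong : ∀ {n} {u v : Vector Carrier n} → (∀ i → u i ≈ v i) →
                        alternatingSum u ≈ alternatingSum v
  alternatingSum-cong {zero}  u≈v = refl
  alternatingSum-cong {suc n} u≈v = +-cong (u≈v zero) (-‿cong (alternatingSum-cong (u≈v ∘ suc)))

  x+-0≈x : ∀ {x y} → y ≈ 0# → x + - y ≈ x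
  x+-0≈x {x} y≈0 = trans (+-congˡ (trans (-‿cong y≈0) -0#≈0#)) (+-identityʳ x)

  alternatingSum-0 : ∀ {n} {v : Vector Carrier n} → (∀ i → v i ≈ 0#) → alternatingSum v ≈ 0#
  alternatingSum-0 {zero}  v≈0 = refl
  alternatingSum-0 {suc n} v≈0 = trans (x+-0≈x (alternatingSum-0 (v≈0 ∘ suc))) (v≈0 zero)

  -- The sign is the parity of `j`. It may stay undetermined because the result only serves to
  -- decide whether a determinant vanishes.
  alternatingSum-single : ∀ {n} (j : Fin n) {v : Vector Carrier n} → (∀ k → k ≢ j → v k ≈ 0#) →
                          alternatingSum v ≈ v j ⊎ alternatingSum v ≈ - v j
  alternatingSum-single zero    v≈0 = inj₁ (x+-0≈x (alternatingSum-0 λ k → v≈0 (suc k) λ ()))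
  alternatingSum-single (suc j) v≈0 =
    [ (λ eq → inj₂ (trans 0+ (-‿cong eq)))
    , (λ eq → inj₁ (trans 0+ (trans (-‿cong eq) (-‿involutive _)))) ]′
    (alternatingSum-single j λ k k≢j → v≈0 (suc k) (k≢j ∘ Finₚ.suc-injective))
    where
    0+ = trans (+-congʳ (v≈0 zero λ ())) (+-identityˡ _)

  det-cong : ∀ {n} {A B : Matrix n} → (∀ i j → A i j ≈ B i j) → det A ≈ det B
  det-cong {zero}  A≈B = refl
  det-cong {suc n} A≈B = alternatingSum-cong λ j →
    *-cong (A≈B zero j) (det-cong λ r c → A≈B (suc r) (punchIn j c))

  replace : ∀ {n} → Matrix n → Fin n → Vector Carrier n → Matrix n
  replace A j u i = updateAt (A i) j (const (u i))

  replace-unique : ∀ {n} {A B : Matrix n} {j u} →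
    (∀ i → B i j ≈ u i) → (∀ i k → k ≢ j → B i k ≈ A i k) → ∀ i k → B i k ≈ replace A j u i k
  replace-unique {A = A} {j = j} at-j off-j i k with k Finₚ.≟ j
  ... | yes ≡.refl = trans (at-j i) (reflexive (≡.sym (updateAt-updates j (A i))))
  ... | no k≢j     = trans (off-j i k k≢j) (reflexive (≡.sym (updateAt-minimal k j (A i) k≢j)))

  -- In the expansion along the first row, the term of column `j` sees `u` only through its first
  -- entry, and every other term sees only the tail of `u`, as a column of its minor.
  det-linear : ∀ {n} (A : Matrix n) j → Linear (λ u → det (replace A j u))
  det-linear {suc n} A j = linear-alternatingSum term
    where
    term : ∀ k → Linear (λ u → replace A j u zero k * det (minor (replace A j u) k))
    term k with k Finₚ.≟ j
    ... | yes ≡.refl = linear-resp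
      (λ u → *-cong (reflexive (updateAt-updates j (A zero)))
        (det-cong λ r c → reflexive (updateAt-minimal (punchIn j c) j (A (suc r)) (Finₚ.punchInᵢ≢i j c))))
      (linear-head (det (minor A j)))
    ... | no k≢j = linear-resp
      (λ u → *-cong (reflexive (updateAt-minimal k j (A zero) k≢j))
        (det-cong (replace-unique
          (λ r → reflexive (≡.trans
            (≡.cong (replace A j u (suc r)) (Finₚ.punchIn-punchOut k≢j))
            (updateAt-updates j (A (suc r)))))
          (λ r c c≢j → reflexive (updateAt-minimal (punchIn k c) j (A (suc r)) λ eq →
            c≢j (Finₚ.punchIn-injective k c _ (≡.trans eq (≡.sym (Finₚ.punchIn-punchOut k≢j)))))))))
      (linear-* (A zero k) (linear-tail (det-linear (minor A k) (punchOut k≢j))))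

  -- Exchange of adjacent columns

  swap : ∀ {n} → Fin n → Fin (suc n) → Fin (suc n)
  swap zero    zero          = suc zero
  swap zero    (suc zero)    = zero
  swap zero    (suc (suc c)) = suc (suc c)
  swap (suc i) zero          = zero
  swap (suc i) (suc c)       = suc (swap i c)

  swap-fst : ∀ {n} (i : Fin n) → swap i (inject₁ i) ≡ suc i
  swap-fst zero    = ≡.refl
  swap-fst (suc i) = ≡.cong suc (swap-fst i)

  swap-snd : ∀ {n} (i : Fin n) → swap i (suc i) ≡ inject₁ i
  swap-snd zero    = ≡.refl
  swap-snd (suc i) = ≡.cong suc (swap-snd i)

  swap-other : ∀ {n} (i : Fin n) {j} → j ≢ inject₁ i → j ≢ suc i → swap i j ≡ j
  swap-other zero    {zero}        j≢i _ = contradiction ≡.refl j≢i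
  swap-other zero    {suc zero}    _ j≢1 = contradiction ≡.refl j≢1
  swap-other zero    {suc (suc j)} _ _   = ≡.refl
  swap-other (suc i) {zero}        _ _   = ≡.refl
  swap-other (suc i) {suc j} j≢i j≢1+i   =
    ≡.cong suc (swap-other i (j≢i ∘ ≡.cong suc) (j≢1+i ∘ ≡.cong suc))

  swap-punchIn-fst : ∀ {n} (i c : Fin n) → swap i (punchIn (inject₁ i) c) ≡ punchIn (suc i) c
  swap-punchIn-fst zero    zero    = ≡.refl
  swap-punchIn-fst zero    (suc c) = ≡.refl
  swap-punchIn-fst (suc i) zero    = ≡.refl
  swap-punchIn-fst (suc i) (suc c) = ≡.cong suc (swap-punchIn-fst i c)

  swap-punchIn-snd : ∀ {n} (i c : Fin n) → swap i (punchIn (suc i) c) ≡ punchIn (inject₁ i) c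
  swap-punchIn-snd zero    zero    = ≡.refl
  swap-punchIn-snd zero    (suc c) = ≡.refl
  swap-punchIn-snd (suc i) zero    = ≡.refl
  swap-punchIn-snd (suc i) (suc c) = ≡.cong suc (swap-punchIn-snd i c)

  -- Deleting a column outside the exchanged pair leaves the pair adjacent, so the induction for
  -- `det-swap` stays within adjacent exchanges.
  swap-punchIn-other : ∀ {n} (i : Fin (suc n)) j → j ≢ inject₁ i → j ≢ suc i →
    Σ (Fin n) λ i′ → ∀ c → swap i (punchIn j c) ≡ punchIn j (swap i′ c)
  swap-punchIn-other zero zero j≢i _ = contradiction ≡.refl j≢i
  swap-punchIn-other zero (suc zero) _ j≢1 = contradiction ≡.refl j≢1
  swap-punchIn-other {suc n} zero (suc (suc j)) _ _ =
    zero , λ { zero → ≡.refl ; (suc zero) → ≡.refl ; (suc (suc c)) → ≡.refl }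
  swap-punchIn-other (suc i) zero _ _ = i , λ c → ≡.refl
  swap-punchIn-other {suc n} (suc i) (suc j) j≢i j≢1+i
    with i′ , eq ← swap-punchIn-other i j (j≢i ∘ ≡.cong suc) (j≢1+i ∘ ≡.cong suc) =
    suc i′ , λ { zero → ≡.refl ; (suc c) → ≡.cong suc (eq c) }

  alternatingSum-swap : ∀ {n} (i : Fin n) {u v : Vector Carrier (suc n)} →
    u (inject₁ i) ≈ v (suc i) → u (suc i) ≈ v (inject₁ i) →
    (∀ j → j ≢ inject₁ i → j ≢ suc i → u j ≈ - v j) →
    alternatingSum u ≈ - alternatingSum v
  alternatingSum-swap {suc n} zero {u} {v} fst snd other = begin
    u zero + - (u (suc zero) + - U)  ≈⟨ +-cong fst (-‿cong (+-cong snd (-‿cong U≈-V))) ⟩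
    b + - (a + - - V)                ≈⟨ +-congˡ (-‿cong (+-congˡ (-‿involutive V))) ⟩
    b + - (a + V)                    ≈⟨ +-congˡ (-‿cong (+-comm a V)) ⟩
    b + - (V + a)                    ≈⟨ +-congˡ (-‿+-comm V a) ⟨
    b + (- V + - a)                  ≈⟨ +-assoc b (- V) (- a) ⟨
    (b + - V) + - a                  ≈⟨ +-comm _ (- a) ⟩
    - a + (b + - V)                  ≈⟨ +-congˡ (-‿involutive _) ⟨
    - a + - - (b + - V)              ≈⟨ -‿+-comm a _ ⟩
    - (a + - (b + - V))              ∎
    where
    a = v zero
    b = v (suc zero)
    U = alternatingSum (λ j → u (suc (suc j)))
    V = alternatingSum (λ j → v (suc (suc j)))
    alternatingSum-neg : ∀ {n} {u v : Vector Carrier n} → (∀ j → u j ≈ - v j) →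
                         alternatingSum u ≈ - alternatingSum v
    alternatingSum-neg {zero}  eq = sym -0#≈0#
    alternatingSum-neg {suc n} eq =
      trans (+-cong (eq zero) (-‿cong (alternatingSum-neg (eq ∘ suc)))) (-‿+-comm _ _)
    U≈-V : U ≈ - V
    U≈-V = alternatingSum-neg λ j → other (suc (suc j)) (λ ()) (λ ())
  alternatingSum-swap (suc i) fst snd other =
    trans (+-cong (other zero (λ ()) (λ ()))
                  (-‿cong (alternatingSum-swap i fst snd λ j j≢ j≢′ →
                    other (suc j) (j≢ ∘ Finₚ.suc-injective) (j≢′ ∘ Finₚ.suc-injective))))
          (-‿+-comm _ _)

  det-swap : ∀ {n} (i : Fin n) (A : Matrix (suc n)) → det (λ r c → A r (swap i c)) ≈ - det A
  det-swap {suc n} i A = alternatingSum-swap i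
    (*-cong (reflexive (≡.cong (A zero) (swap-fst i)))
            (det-cong λ r c → reflexive (≡.cong (A (suc r)) (swap-punchIn-fst i c))))
    (*-cong (reflexive (≡.cong (A zero) (swap-snd i)))
            (det-cong λ r c → reflexive (≡.cong (A (suc r)) (swap-punchIn-snd i c))))
    λ j j≢i j≢1+i → let i′ , eq = swap-punchIn-other i j j≢i j≢1+i in
      trans (*-cong (reflexive (≡.cong (A zero) (swap-other i j≢i j≢1+i)))
              (trans (det-cong λ r c → reflexive (≡.cong (A (suc r)) (eq c)))
                     (det-swap i′ (minor A j))))
            (sym (-‿distribʳ-* _ _))

  -- Elimination and kernels over a domain

  module OverDomain
    (1≉0 : ¬ (1# ≈ 0#))
    (x≈0? : ∀ x → Dec (x ≈ 0#))
    (no-zero-divisors : ∀ {x y} → x * y ≈ 0# → ¬ (x ≈ 0#) → y ≈ 0#)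
    (x≈-x⇒x≈0 : ∀ {x} → x ≈ - x → x ≈ 0#)
    where

    private
      -- Adjacent exchanges move the right-hand column leftwards until the two equal columns are
      -- neighbours. One more exchange then fixes the matrix and negates the determinant.
      det-equal-columns-< : ∀ {n} k (A : Matrix (suc n)) j → j Fin.< k →
                            (∀ r → A r j ≈ A r k) → det A ≈ 0#
      det-equal-columns-< = <-weakInduction _ (λ _ _ ()) step
        where
        step : ∀ {n} i →
          (∀ (A : Matrix (suc n)) j → j Fin.< inject₁ i → (∀ r → A r j ≈ A r (inject₁ i)) → det A ≈ 0#) →
          ∀ (A : Matrix (suc n)) j → j Fin.< suc i → (∀ r → A r j ≈ A r (suc i)) → det A ≈ 0#
        step i ih A j j<1+i eq with j Finₚ.≟ inject₁ i
        ... | yes ≡.refl = x≈-x⇒x≈0 (trans (det-cong invariant) (det-swap i A))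
          where
          invariant : ∀ r c → A r c ≈ A r (swap i c)
          invariant r c with c Finₚ.≟ inject₁ i | c Finₚ.≟ suc i
          ... | yes ≡.refl | _          = trans (eq r) (reflexive (≡.cong (A r) (≡.sym (swap-fst i))))
          ... | no _       | yes ≡.refl = trans (sym (eq r)) (reflexive (≡.cong (A r) (≡.sym (swap-snd i))))
          ... | no c≢i     | no c≢1+i   = reflexive (≡.cong (A r) (≡.sym (swap-other i c≢i c≢1+i)))
        ... | no j≢i =
          trans (sym (-‿involutive _)) (trans (-‿cong (trans (sym (det-swap i A)) swapped≈0)) -0#≈0#)
          where
          j<i : j Fin.< inject₁ i
          j<i = Finₚ.≤∧≢⇒< (≡.subst (toℕ j ℕ.≤_) (≡.sym (Finₚ.toℕ-inject₁ i)) (ℕₚ.≤-pred j<1+i)) j≢i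
          swapped≈0 : det (λ r c → A r (swap i c)) ≈ 0#
          swapped≈0 = ih (λ r c → A r (swap i c)) j j<i λ r →
            trans (reflexive (≡.cong (A r) (swap-other i j≢i (Finₚ.<⇒≢ j<1+i))))
                  (trans (eq r) (reflexive (≡.cong (A r) (≡.sym (swap-fst i)))))

    det-equal-columns : ∀ {n} (A : Matrix n) j k → j ≢ k → (∀ r → A r j ≈ A r k) → det A ≈ 0#
    det-equal-columns {suc n} A j k j≢k eq with Finₚ.<-cmp j k
    ... | tri< j<k _ _ = det-equal-columns-< k A j j<k eq
    ... | tri≈ _ j≡k _ = contradiction j≡k j≢k
    ... | tri> _ _ k<j = det-equal-columns-< j A k k<j (sym ∘ eq)

    det-column-operation : ∀ {n} (A : Matrix n) j k → k ≢ j → ∀ c b →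
      det (replace A k (λ i → c * A i k + b * A i j)) ≈ c * det A
    det-column-operation A j k k≢j c b = begin
      det (replace A k (λ i → c * A i k + b * A i j))
        ≈⟨ linear-combination (det-linear A k) c b (λ i → A i k) (λ i → A i j) ⟩
      c * det (replace A k (λ i → A i k)) + b * det (replace A k (λ i → A i j))
        ≈⟨ +-cong (*-congˡ (det-cong (λ i l → sym (replace-unique {A = A} (λ i → refl) (λ i l _ → refl) i l))))
                  (*-congˡ (det-equal-columns _ j k (k≢j ∘ ≡.sym) λ r → reflexive
                    (≡.trans (updateAt-minimal j k (A r) (k≢j ∘ ≡.sym)) (≡.sym (updateAt-updates k (A r)))))) ⟩
      c * det A + b * 0#
        ≈⟨ +-congˡ (zeroʳ b) ⟩
      c * det A + 0#
        ≈⟨ +-identityʳ _ ⟩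
      c * det A ∎

    module Elimination {n} (A : Matrix n) (j : Fin n) (c : Carrier) (b : Vector Carrier n) where

      -- Column elimination without division: every column except `j` is scaled by `c` before a
      -- multiple of column `j` is added. With the pivot as `c` it clears the first row; with `c`
      -- equal to one it forms the differences of homogenized points.
      eliminated : Matrix n
      eliminated i k with k Finₚ.≟ j
      ... | yes _ = A i j
      ... | no _  = c * A i k + b k * A i j

      eliminated-pivot : ∀ i → eliminated i j ≡ A i j
      eliminated-pivot i with j Finₚ.≟ j
      ... | yes _  = ≡.refl
      ... | no j≢j = contradiction ≡.refl j≢j

      eliminated-other : ∀ i {k} → k ≢ j → eliminated i k ≡ c * A i k + b k * A i j
      eliminated-other i {k} k≢j with k Finₚ.≟ j
      ... | yes k≡j = contradiction k≡j k≢j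
      ... | no _    = ≡.refl

      private
        -- Columns with index below `m` have been treated. Column `j` keeps its value throughout, so
        -- each further stage is at most one column operation.
        stage : ℕ → Matrix n
        stage m i k with toℕ k ℕₚ.<? m
        ... | yes _ = eliminated i k
        ... | no _  = A i k

        stage-< : ∀ {m} i k → toℕ k ℕ.< m → stage m i k ≡ eliminated i k
        stage-< {m} i k k<m with toℕ k ℕₚ.<? m
        ... | yes _  = ≡.refl
        ... | no k≮m = contradiction k<m k≮m

        stage-≥ : ∀ {m} i k → ¬ (toℕ k ℕ.< m) → stage m i k ≡ A i k
        stage-≥ {m} i k k≮m with toℕ k ℕₚ.<? m
        ... | yes k<m = contradiction k<m k≮m
        ... | no _    = ≡.refl

        stage-pivot : ∀ m i → stage m i j ≡ A i j
        stage-pivot m i with toℕ j ℕₚ.<? m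
        ... | yes _ = eliminated-pivot i
        ... | no _  = ≡.refl

        stage-suc : ∀ m i k → toℕ k ≢ m → stage (suc m) i k ≡ stage m i k
        stage-suc m i k k≢m with toℕ k ℕₚ.<? m
        ... | yes k<m = stage-< i k (ℕₚ.m<n⇒m<1+n k<m)
        ... | no k≮m  = stage-≥ i k λ k<1+m → k≮m (ℕₚ.≤∧≢⇒< (ℕₚ.≤-pred k<1+m) k≢m)

        -- The exponent counts the treated columns other than `j`. Its value can stay hidden, since
        -- it is only used with `c` nonzero, where the power is nonzero, or with `c` equal to one.
        det-stage : ∀ m → ∃[ e ] (det (stage m) ≈ c ^ e * det A)
        det-stage zero = 0 , sym (*-identityˡ _)
        det-stage (suc m) with det-stage m | m ℕₚ.<? n
        ... | e , eq | no m≮n = e , trans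
          (det-cong λ i k → reflexive (stage-suc m i k λ k≡m → m≮n (≡.subst (ℕ._< n) k≡m (Finₚ.toℕ<n k)))) eq
        ... | e , eq | yes m<n with fromℕ< m<n Finₚ.≟ j
        ...   | yes m≡j = e , trans (det-cong λ i k → unchanged i k) eq
          where
          unchanged : ∀ i k → stage (suc m) i k ≈ stage m i k
          unchanged i k with k Finₚ.≟ j
          ... | yes ≡.refl = reflexive (≡.trans (stage-pivot (suc m) i) (≡.sym (stage-pivot m i)))
          ... | no k≢j     = reflexive (stage-suc m i k λ k≡m → k≢j (≡.trans
            (Finₚ.toℕ-injective (≡.trans k≡m (≡.sym (Finₚ.toℕ-fromℕ< m<n)))) m≡j))
        ...   | no m≢j = suc e , (begin
          det (stage (suc m))  ≈⟨ det-cong (replace-unique {A = stage m} at-m off-m) ⟩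
          det (replace (stage m) k₀ (λ i → c * stage m i k₀ + b k₀ * stage m i j))
                               ≈⟨ det-column-operation (stage m) j k₀ m≢j c (b k₀) ⟩
          c * det (stage m)    ≈⟨ *-congˡ eq ⟩
          c * (c ^ e * det A)  ≈⟨ *-assoc c (c ^ e) (det A) ⟨
          c ^ suc e * det A    ∎)
          where
          k₀ = fromℕ< m<n
          toℕ-k₀ = Finₚ.toℕ-fromℕ< m<n
          at-m : ∀ i → stage (suc m) i k₀ ≈ c * stage m i k₀ + b k₀ * stage m i j
          at-m i = reflexive (≡.trans (stage-< i k₀ (ℕₚ.≤-reflexive (≡.cong suc toℕ-k₀)))
            (≡.trans (eliminated-other i m≢j)
              (≡.sym (≡.cong₂ (λ s t → c * s + b k₀ * t)
                (stage-≥ i k₀ (λ k₀<m → ℕₚ.<-irrefl toℕ-k₀ k₀<m)) (stage-pivot m i)))))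
          off-m : ∀ i k → k ≢ k₀ → stage (suc m) i k ≈ stage m i k
          off-m i k k≢k₀ = reflexive (stage-suc m i k λ k≡m →
            k≢k₀ (Finₚ.toℕ-injective (≡.trans k≡m (≡.sym toℕ-k₀))))

      det-eliminated : ∃[ e ] (det eliminated ≈ c ^ e * det A)
      det-eliminated = let e , eq = det-stage n in
        e , trans (det-cong λ i k → reflexive (≡.sym (stage-< i k (Finₚ.toℕ<n k)))) eq

    open Elimination

    ^≉0 : ∀ {c} → ¬ (c ≈ 0#) → ∀ e → ¬ (c ^ e ≈ 0#)
    ^≉0 c≉0 zero    = 1≉0
    ^≉0 c≉0 (suc e) cc^e≈0 = ^≉0 c≉0 e (no-zero-divisors cc^e≈0 c≉0)

    dot-eliminated : ∀ {n} (A : Matrix n) j c b a {k} → k ≢ j →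
      dot a (λ i → eliminated A j c b i k) ≈ c * dot a (λ i → A i k) + b k * dot a (λ i → A i j)
    dot-eliminated A j c b a {k} k≢j = begin
      dot a (λ i → eliminated A j c b i k)
        ≈⟨ dot-cong {a = a} (λ _ → refl) (λ i → reflexive (eliminated-other A j c b i k≢j)) ⟩
      dot a (λ i → c * A i k + b k * A i j)
        ≈⟨ linear-combination (a , λ _ → refl) c (b k) (λ i → A i k) (λ i → A i j) ⟩
      c * dot a (λ i → A i k) + b k * dot a (λ i → A i j) ∎

    module Pivot {n} (A : Matrix (suc n)) (j : Fin (suc n)) (α≉0 : ¬ (A zero j ≈ 0#)) where

      α = A zero j

      reduced : Matrix (suc n)
      reduced = eliminated A j α (λ k → - A zero k)

      first-row : ∀ {k} → k ≢ j → reduced zero k ≈ 0#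
      first-row {k} k≢j = begin
        reduced zero k                    ≡⟨ eliminated-other A j α _ zero k≢j ⟩
        α * A zero k + (- A zero k) * α   ≈⟨ +-cong (*-comm α (A zero k)) (sym (-‿distribˡ-* (A zero k) α)) ⟩
        A zero k * α + - (A zero k * α)   ≈⟨ -‿inverseʳ _ ⟩
        0#                                ∎

      det-reduced : det reduced ≈ α * det (minor reduced j) ⊎ det reduced ≈ - (α * det (minor reduced j))
      det-reduced = [ (λ eq → inj₁ (trans eq at-j)) , (λ eq → inj₂ (trans eq (-‿cong at-j))) ]′
        (alternatingSum-single j {λ k → reduced zero k * det (minor reduced k)}
          λ k k≢j → trans (*-congʳ (first-row k≢j)) (zeroˡ (det (minor reduced k))))
        where at-j = *-congʳ (reflexive (eliminated-pivot A j α _ zero))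

      det≈0⇒minor≈0 : det A ≈ 0# → det (minor reduced j) ≈ 0#
      det≈0⇒minor≈0 det≈0 with det-eliminated A j α (λ k → - A zero k) | det-reduced
      ... | e , eq | inj₁ eq′ = no-zero-divisors (trans (sym eq′) (trans eq (trans (*-congˡ det≈0) (zeroʳ _)))) α≉0
      ... | e , eq | inj₂ eq′ = no-zero-divisors (trans (sym (-‿involutive _)) (trans (-‿cong
              (trans (sym eq′) (trans eq (trans (*-congˡ det≈0) (zeroʳ _))))) -0#≈0#)) α≉0

      minor≈0⇒det≈0 : det (minor reduced j) ≈ 0# → det A ≈ 0#
      minor≈0⇒det≈0 minor≈0 with det-eliminated A j α (λ k → - A zero k)
      ... | e , eq = no-zero-divisors (trans (sym eq) reduced≈0) (^≉0 α≉0 e)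
        where
        product≈0 = trans (*-congˡ minor≈0) (zeroʳ α)
        reduced≈0 : det reduced ≈ 0#
        reduced≈0 = [ (λ eq → trans eq product≈0)
                    , (λ eq → trans eq (trans (-‿cong product≈0) -0#≈0#)) ]′ det-reduced

      -- The reduced first row vanishes off column `j`, so the first entry of `a` drops out of the
      -- product.
      dot-minor : ∀ (a : Vector Carrier (suc n)) {k} (j≢k : j ≢ k) →
        dot (a ∘ suc) (λ i → minor reduced j i (punchOut j≢k)) ≈
        α * dot a (λ i → A i k) + - A zero k * dot a (λ i → A i j)
      dot-minor a {k} j≢k = begin
        dot (a ∘ suc) (λ i → minor reduced j i (punchOut j≢k))
          ≈⟨ dot-cong {a = a ∘ suc} (λ _ → refl)
               (λ i → reflexive (≡.cong (reduced (suc i)) (Finₚ.punchIn-punchOut j≢k))) ⟩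
        dot (a ∘ suc) (λ i → reduced (suc i) k)
          ≈⟨ +-identityˡ _ ⟨
        0# + dot (a ∘ suc) (λ i → reduced (suc i) k)
          ≈⟨ +-congʳ (trans (*-congˡ (first-row (j≢k ∘ ≡.sym))) (zeroʳ (a zero))) ⟨
        dot a (λ i → reduced i k)
          ≈⟨ dot-eliminated A j α _ a (j≢k ∘ ≡.sym) ⟩
        α * dot a (λ i → A i k) + - A zero k * dot a (λ i → A i j) ∎

    -- A nonzero entry of the first row serves as pivot. Elimination leaves a regular minor whose
    -- columns are orthogonal to the tail of `a`, so the tail vanishes by induction; the pivot
    -- column then gives `a zero * α ≈ 0#`.
    regular⇒kernel-trivial : ∀ {n} (A : Matrix n) → ¬ (det A ≈ 0#) →
      ∀ a → (∀ j → dot a (λ i → A i j) ≈ 0#) → ∀ i → a i ≈ 0#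
    regular⇒kernel-trivial {suc n} A det≉0 a a⊥A with Finₚ.all? (λ k → x≈0? (A zero k))
    ... | yes row≈0 = contradiction 
      (alternatingSum-0 {v = λ k → A zero k * det (minor A k)}
        λ k → trans (*-congʳ (row≈0 k)) (zeroˡ (det (minor A k)))) det≉0
    ... | no ¬row≈0 = λ { zero → a₀≈0 ; (suc i) → tail≈0 i }
      where
      pivot = Finₚ.¬∀⟶∃¬ (suc n) (λ k → A zero k ≈ 0#) (λ k → x≈0? (A zero k)) ¬row≈0
      j = proj₁ pivot
      α≉0 = proj₂ pivot
      open Pivot A j α≉0
      tail≈0 : ∀ i → a (suc i) ≈ 0#
      tail≈0 = regular⇒kernel-trivial (minor reduced j) (det≉0 ∘ minor≈0⇒det≈0) (a ∘ suc) λ c → begin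
        dot (a ∘ suc) (λ i → minor reduced j i c)
          ≡⟨ ≡.cong (λ c → dot (a ∘ suc) (λ i → minor reduced j i c)) (Finₚ.punchOut-punchIn j) ⟨
        dot (a ∘ suc) (λ i → minor reduced j i (punchOut (Finₚ.punchInᵢ≢i j c ∘ ≡.sym)))
          ≈⟨ dot-minor a (Finₚ.punchInᵢ≢i j c ∘ ≡.sym) ⟩
        α * dot a (λ i → A i (punchIn j c)) + - A zero (punchIn j c) * dot a (λ i → A i j)
          ≈⟨ +-cong (trans (*-congˡ (a⊥A _)) (zeroʳ _)) (trans (*-congˡ (a⊥A j)) (zeroʳ _)) ⟩
        0# + 0#
          ≈⟨ +-identityʳ 0# ⟩
        0# ∎
      a₀≈0 : a zero ≈ 0#
      a₀≈0 = no-zero-divisors (begin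
        α * a zero                                       ≈⟨ *-comm α (a zero) ⟩
        a zero * α                                       ≈⟨ +-identityʳ _ ⟨
        a zero * α + 0#                                  ≈⟨ +-congˡ (dot-0ˡ (λ i → A (suc i) j)) ⟨
        a zero * α + dot (const 0#) (λ i → A (suc i) j)  ≈⟨ +-congˡ (dot-cong tail≈0 (λ _ → refl)) ⟨
        dot a (λ i → A i j)                              ≈⟨ a⊥A j ⟩
        0#                                               ∎) α≉0

    -- If the first row vanishes, the first unit vector is orthogonal to every column. Otherwise the
    -- reduced minor is singular, and a kernel vector of it extends to the whole matrix.
    singular⇒kernel-nontrivial : ∀ {n} (A : Matrix n) → det A ≈ 0# →
      ∃[ a ] (¬ (∀ i → a i ≈ 0#) × ∀ j → dot a (λ i → A i j) ≈ 0#)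
    singular⇒kernel-nontrivial {zero}  A 1≈0 = contradiction 1≈0 1≉0
    singular⇒kernel-nontrivial {suc n} A det≈0 with Finₚ.all? (λ k → x≈0? (A zero k))
    ... | yes row≈0 = e₀ , (λ e₀≈0 → 1≉0 (e₀≈0 zero)) , λ j →
      trans (+-cong (trans (*-congˡ (row≈0 j)) (zeroʳ 1#)) (dot-0ˡ (λ i → A (suc i) j))) (+-identityʳ 0#)
      where
      e₀ : Vector Carrier (suc n)
      e₀ zero    = 1#
      e₀ (suc _) = 0#
    ... | no ¬row≈0 = a , a≉0 , a⊥A
      where
      pivot = Finₚ.¬∀⟶∃¬ (suc n) (λ k → A zero k ≈ 0#) (λ k → x≈0? (A zero k)) ¬row≈0
      j = proj₁ pivot
      α≉0 = proj₂ pivot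
      open Pivot A j α≉0
      kernel = singular⇒kernel-nontrivial (minor reduced j) (det≈0⇒minor≈0 det≈0)
      a′ = proj₁ kernel
      β = dot a′ (λ i → A (suc i) j)
      -- Scaling `a′` by the pivot replaces division: column `j` then contributes `- β * α + α * β`,
      -- and the other columns follow from `dot-minor` after cancelling `α`.
      a : Vector Carrier (suc n)
      a zero    = - β
      a (suc i) = α * a′ i
      a≉0 : ¬ (∀ i → a i ≈ 0#)
      a≉0 a≈0 = proj₁ (proj₂ kernel) λ i → no-zero-divisors (a≈0 (suc i)) α≉0
      a⊥Aⱼ : dot a (λ i → A i j) ≈ 0#
      a⊥Aⱼ = begin
        - β * α + dot (λ i → α * a′ i) (λ i → A (suc i) j)  ≈⟨ +-cong (sym (-‿distribˡ-* β α)) (dot-*ˡ α a′ _) ⟩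
        - (β * α) + α * β                                   ≈⟨ +-congˡ (*-comm α β) ⟩
        - (β * α) + β * α                                   ≈⟨ -‿inverseˡ _ ⟩
        0#                                                  ∎
      a⊥A : ∀ k → dot a (λ i → A i k) ≈ 0#
      a⊥A k with j Finₚ.≟ k
      ... | yes ≡.refl = a⊥Aⱼ
      ... | no j≢k = no-zero-divisors (begin
        α * dot a (λ i → A i k)
          ≈⟨ +-identityʳ _ ⟨
        α * dot a (λ i → A i k) + 0#
          ≈⟨ +-congˡ (trans (*-congˡ a⊥Aⱼ) (zeroʳ _)) ⟨
        α * dot a (λ i → A i k) + - A zero k * dot a (λ i → A i j)
          ≈⟨ dot-minor a j≢k ⟨
        dot (a ∘ suc) (λ i → minor reduced j i (punchOut j≢k))
          ≈⟨ dot-*ˡ α a′ _ ⟩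
        α * dot a′ (λ i → minor reduced j i (punchOut j≢k))
          ≈⟨ *-congˡ (proj₂ (proj₂ kernel) (punchOut j≢k)) ⟩
        α * 0#
          ≈⟨ zeroʳ α ⟩
        0# ∎) α≉0

-- Ramsey theory of transitive colourings

module Lists {A : Set} where

  open import Data.Nat.Base using (_+_; _≤_)
  open ≡ using (refl; sym; trans; cong; subst)

  length-filter-split : ∀ {P : A → Set} (P? : Decidable P) xs →
    length (filter P? xs) + length (filter (¬? ∘ P?) xs) ≡ length xs
  length-filter-split P? [] = refl
  length-filter-split P? (x ∷ xs) with P? x
  ... | yes _ = cong suc (length-filter-split P? xs)
  ... | no _  = trans (ℕₚ.+-suc _ _) (cong suc (length-filter-split P? xs))

  AllPairs-reverse : ∀ {R : Rel A 0ℓ} {xs} → AllPairs (flip R) xs → AllPairs R (reverse xs)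
  AllPairs-reverse [] = []
  AllPairs-reverse {R} {x ∷ xs} (px ∷ pxs) = subst (AllPairs R) (sym (Listₚ.unfold-reverse x xs))
    (AllPairsₚ.++⁺ (AllPairs-reverse pxs) ([] ∷ []) (All.tabulate λ y∈ → All.lookup px (Anyₚ.reverse⁻ y∈) ∷ []))

  m+n≤1+o+p⇒m≤o⊎n≤p : ∀ {m n o p} → m + n ≤ suc (o + p) → m ≤ o ⊎ n ≤ p
  m+n≤1+o+p⇒m≤o⊎n≤p {m} {n} {o} {p} le with m ℕₚ.≤? o | n ℕₚ.≤? p
  ... | yes m≤o | _       = inj₁ m≤o
  ... | no _    | yes n≤p = inj₂ n≤p
  ... | no m≰o  | no n≰p  = contradiction le (ℕₚ.<⇒≱ (subst (_≤ m + n)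
    (cong suc (ℕₚ.+-suc o p)) (ℕₚ.+-mono-≤ (ℕₚ.≰⇒> m≰o) (ℕₚ.≰⇒> n≰p))))

  filter-pigeonhole : ∀ {P : A → Set} (P? : Decidable P) xs {m n} → m + n ≤ suc (length xs) →
    m ≤ length (filter P? xs) ⊎ n ≤ length (filter (¬? ∘ P?) xs)
  filter-pigeonhole P? xs le = m+n≤1+o+p⇒m≤o⊎n≤p
    (ℕₚ.≤-trans le (ℕₚ.≤-reflexive (cong suc (sym (length-filter-split P? xs)))))

  All-∈-filter⁻ : ∀ {Q : A → Set} (Q? : Decidable Q) xs {zs} →
    All (_∈ filter Q? xs) zs → All (_∈ xs) zs
  All-∈-filter⁻ Q? xs = All.map (proj₁ ∘ ∈-filter⁻ Q? {xs = xs})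

  Constant : (A → Sign) → List A → Set
  Constant t xs = ∃[ s ] All (λ x → t x ≡ s) xs

  constant-half : ∀ (t : A → Sign) xs {n} → n + n ≤ length xs →
    Σ Sign λ s → n ≤ length (filter (λ x → t x Signₚ.≟ s) xs)
  constant-half t xs le with filter-pigeonhole (λ x → t x Signₚ.≟ Sign.+) xs (ℕₚ.m≤n⇒m≤1+n le)
  ... | inj₁ n≤ = Sign.+ , n≤
  ... | inj₂ n≤ = Sign.- , ℕₚ.≤-trans n≤ (ℕₚ.≤-reflexive (cong length (Listₚ.filter-≐ _ _ (not-+ , not--) xs)))
    where
    not-+ : ∀ {x} → t x ≢ Sign.+ → t x ≡ Sign.-
    not-+ {x} tx≢+ with t x
    ... | Sign.- = refl
    ... | Sign.+ = contradiction refl tx≢+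
    not-- : ∀ {x} → t x ≡ Sign.- → t x ≢ Sign.+
    not-- eq eq′ with () ← trans (sym eq) eq′

module Ordered {A : Set} (_≺_ : Rel A 0ℓ) (≺-trans : Transitive _≺_) (≺-irrefl : ∀ {x} → ¬ (x ≺ x)) where

  open ≡ using (refl)

  Sorted : List A → Set
  Sorted = AllPairs _≺_

  sorted⇒AllPairs : ∀ {R : Rel A 0ℓ} {xs} → Sorted xs →
    (∀ {x y} → x ∈ xs → y ∈ xs → x ≺ y → R x y) → AllPairs R xs
  sorted⇒AllPairs [] f = []
  sorted⇒AllPairs (x≺ ∷ s) f =
    All.tabulate (λ y∈ → f (here refl) (there y∈) (All.lookup x≺ y∈))
    ∷ sorted⇒AllPairs s λ x∈ y∈ → f (there x∈) (there y∈)

  AllPairs-lookup : ∀ {R : Rel A 0ℓ} {xs} → Sorted xs → AllPairs R xs →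
    ∀ {x y} → x ∈ xs → y ∈ xs → x ≺ y → R x y
  AllPairs-lookup (x≺ ∷ s) (r ∷ rs) (here refl) (here refl) x≺x = contradiction x≺x ≺-irrefl
  AllPairs-lookup (x≺ ∷ s) (r ∷ rs) (here refl) (there y∈)  x≺y = All.lookup r y∈
  AllPairs-lookup (y≺ ∷ s) (r ∷ rs) (there x∈)  (here refl) x≺y =
    contradiction (≺-trans (All.lookup y≺ x∈) x≺y) ≺-irrefl
  AllPairs-lookup (_ ∷ s)  (r ∷ rs) (there x∈)  (there y∈)  x≺y = AllPairs-lookup s rs x∈ y∈ x≺y

-- Chains of a transitive ternary relation

module Triples {A : Set} (_≺_ : Rel A 0ℓ) (≺-trans : Transitive _≺_) (≺-irrefl : ∀ {x} → ¬ (x ≺ x))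
               (T : A → A → A → Set)
               (T-trans : ∀ {a b c d} → T a b c → T b c d → T a b d × T a c d) where

  open ≡ using (refl)
  open Ordered _≺_ ≺-trans ≺-irrefl

  AllTriples : List A → Set
  AllTriples []       = ⊤
  AllTriples (x ∷ xs) = AllPairs (T x) xs × AllTriples xs

  AllTriples-lookup : ∀ {xs} → Sorted xs → AllTriples xs →
    ∀ {a b c} → a ∈ xs → b ∈ xs → c ∈ xs → a ≺ b → b ≺ c → T a b c
  AllTriples-lookup (x≺ ∷ s) (p , _) (here refl) (here refl) _ a≺a _ = contradiction a≺a ≺-irrefl
  AllTriples-lookup (x≺ ∷ s) (p , _) (here refl) (there b∈) (here refl) a≺b b≺a =
    contradiction (≺-trans a≺b b≺a) ≺-irrefl
  AllTriples-lookup (x≺ ∷ s) (p , _) (here refl) (there b∈) (there c∈) a≺b b≺c =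
    AllPairs-lookup s p b∈ c∈ b≺c
  AllTriples-lookup (x≺ ∷ s) (_ , q) (there a∈) (here refl) _ a≺x _ =
    contradiction (≺-trans a≺x (All.lookup x≺ a∈)) ≺-irrefl
  AllTriples-lookup (x≺ ∷ s) (_ , q) (there a∈) (there b∈) (here refl) a≺b b≺x =
    contradiction (≺-trans b≺x (All.lookup x≺ b∈)) ≺-irrefl
  AllTriples-lookup (_ ∷ s) (_ , q) (there a∈) (there b∈) (there c∈) a≺b b≺c =
    AllTriples-lookup s q a∈ b∈ c∈ a≺b b≺c

  -- A single new triple suffices. Transitivity carries `T y x v` through `T x v w` to every
  -- `T y x w`, and then `T y x p` with `T x p q` gives `T y p q`.
  AllTriples-cons : ∀ {y x v ws} → T y x v → AllTriples (x ∷ v ∷ ws) → AllTriples (y ∷ x ∷ v ∷ ws)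
  AllTriples-cons {y} {x} {v} {ws} yxv q@(p@(xv ∷ _) , _) = (yx ∷ pairs p yx) , q
    where
    yx : All (T y x) (v ∷ ws)
    yx = yxv ∷ All.map (proj₁ ∘ T-trans yxv) xv
    pairs : ∀ {ps} → AllPairs (T x) ps → All (T y x) ps → AllPairs (T y) ps
    pairs []       []        = []
    pairs (r ∷ rs) (yx ∷ ys) = All.map (proj₂ ∘ T-trans yx) r ∷ pairs rs ys

module RamseyForTransitive
  (em : ExcludedMiddle 0ℓ)
  {A : Set} (_≺_ : Rel A 0ℓ) (≺-trans : Transitive _≺_) (≺-irrefl : ∀ {x} → ¬ (x ≺ x))
  (P : A → Set) where

  open import Data.Nat.Base using (_+_; _*_; _^_; _≤_; _<_)
  open ≡ using (refl; sym; trans; cong; subst)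
  open Lists
  open Ordered _≺_ ≺-trans ≺-irrefl

  -- Elements that end an R⁺-chain of maximal length are pairwise related by R⁻.
  module Pairs
    (R⁺ R⁻ : Rel A 0ℓ) (R⁺-trans : Transitive R⁺)
    (R-total : ∀ {x y} → P x → P y → x ≺ y → R⁺ x y ⊎ R⁻ x y) where

    EndsChain : ℕ → List A → A → Set
    EndsChain k xs x = ∃[ zs ] (length zs ≡ k × All (_∈ xs) (x ∷ zs) × AllPairs (flip R⁺) (x ∷ zs))

    -- The bound splits into `l + 1` and `k * l + 1`. Either more than `l` elements end an
    -- `R⁺`-chain with `k` predecessors, and they are pairwise `R⁻`-related unless such a chain can
    -- be prolonged; or more than `k * l` elements do not, and the recursion on those can only
    -- return its second alternative.
    monotone : ∀ k l xs → Sorted xs → All P xs → k * l < length xs →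
      (∃[ x ] EndsChain k xs x) ⊎
      (∃[ zs ] (length zs ≡ suc l × All (_∈ xs) zs × AllPairs R⁻ zs))
    monotone zero    l (x ∷ xs) s ps lt = inj₁ (x , [] , refl , here refl ∷ [] , [] ∷ [])
    monotone (suc k) l xs       s ps lt = decide
      (filter-pigeonhole end? xs {suc l} {suc (k * l)}
        (s≤s (ℕₚ.≤-trans (ℕₚ.≤-reflexive (ℕₚ.+-suc l (k * l))) lt)))
      where
      end? : Decidable (EndsChain k xs)
      end? x = em
      decide : _ → _
      decide (inj₁ l<) with em {∃[ x ] EndsChain (suc k) xs x}
      ... | yes chain = inj₁ chain
      ... | no none   = inj₂ (take (suc l) ends
                      , trans (Listₚ.length-take (suc l) ends) (ℕₚ.m≤n⇒m⊓n≡m l<)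
                      , Allₚ.take⁺ (suc l) (All-∈-filter⁻ end? xs (All.tabulate λ z∈ → z∈))
                      , AllPairsₚ.take⁺ (suc l) (sorted⇒AllPairs (AllPairsₚ.filter⁺ end? s) decreasing))
        where
        ends = filter end? xs
        decreasing : ∀ {x y} → x ∈ ends → y ∈ ends → x ≺ y → R⁻ x y
        decreasing x∈ y∈ x≺y with ∈-filter⁻ end? {xs = xs} x∈ | ∈-filter⁻ end? {xs = xs} y∈
        ... | x∈xs , zs , len , zs∈ , chain@(zs≺x ∷ _) | y∈xs , _
            with R-total (All.lookup ps x∈xs) (All.lookup ps y∈xs) x≺y
        ... | inj₂ r⁻ = r⁻
        ... | inj₁ r⁺ = contradiction
          (_ , _ ∷ zs , cong suc len , y∈xs ∷ zs∈ , (r⁺ ∷ All.map (λ r → R⁺-trans r r⁺) zs≺x) ∷ chain) none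
      decide (inj₂ kl<)
          with monotone k l (filter (¬? ∘ end?) xs) (AllPairsₚ.filter⁺ (¬? ∘ end?) s) (Allₚ.filter⁺ (¬? ∘ end?) ps) kl<
      ... | inj₂ (zs , len , zs∈ , chain) = inj₂ (zs , len , All-∈-filter⁻ (¬? ∘ end?) xs zs∈ , chain)
      ... | inj₁ (x , zs , len , zs∈@(x∈ ∷ _) , chain) = contradiction
        (zs , len , All-∈-filter⁻ (¬? ∘ end?) xs zs∈ , chain) (proj₂ (∈-filter⁻ (¬? ∘ end?) {xs = xs} x∈))

  -- If x ends a cup and begins a cap, the colour of the triple around x decides which of the
  -- two can be extended.
  module CupsCaps
    (T⁺ T⁻ : A → A → A → Set)
    (T⁺-trans : ∀ {a b c d} → T⁺ a b c → T⁺ b c d → T⁺ a b d × T⁺ a c d)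
    (T⁻-trans : ∀ {a b c d} → T⁻ a b c → T⁻ b c d → T⁻ a b d × T⁻ a c d)
    (T-total : ∀ {a b c} → P a → P b → P c → a ≺ b → b ≺ c → T⁺ a b c ⊎ T⁻ a b c) where

    _≻_ : Rel A 0ℓ
    _≻_ = flip _≺_

    ≻-trans : Transitive _≻_
    ≻-trans x≻y y≻z = ≺-trans y≻z x≻y

    flipped : (A → A → A → Set) → A → A → A → Set
    flipped T a b c = T c b a

    module Cups = Triples _≻_ ≻-trans ≺-irrefl (flipped T⁺) (λ s t → Product.swap (T⁺-trans t s))
    module Caps = Triples _≺_ ≺-trans ≺-irrefl T⁻ T⁻-trans

    -- A cup is listed from its last point to its first, a cap from its first to its last;
    -- both have two more points than k says.
    CupFrom : ℕ → List A → A → Set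
    CupFrom k xs x = ∃[ y ] ∃[ zs ] (length zs ≡ k × All (_∈ xs) (x ∷ y ∷ zs) ×
      AllPairs _≻_ (x ∷ y ∷ zs) × Cups.AllTriples (x ∷ y ∷ zs))

    CapFrom : ℕ → List A → A → Set
    CapFrom k xs x = ∃[ y ] ∃[ zs ] (length zs ≡ k × All (_∈ xs) (x ∷ y ∷ zs) ×
      AllPairs _≺_ (x ∷ y ∷ zs) × Caps.AllTriples (x ∷ y ∷ zs))

    private
      at-least-two : ∀ n → 2 ≤ 2 ^ suc n
      at-least-two n = ℕₚ.^-monoʳ-≤ 2 {1} {suc n} (s≤s z≤n)

    -- The powers of two satisfy the Erdős-Szekeres recursion: one half of the points covers the
    -- case `(k + 1, l)` inside the ends of `k`-cups, the other the case `(k, l + 1)` outside them.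
    -- Outside, a `k`-cup would make its last point such an end, so only the cap remains.
    cups-caps : ∀ k l xs → Sorted xs → All P xs → 2 ^ suc (k + l) ≤ length xs →
      (∃[ x ] CupFrom k xs x) ⊎ (∃[ x ] CapFrom l xs x)
    cups-caps zero l xs s ps le with xs | s | ℕₚ.≤-trans (at-least-two l) le
    ... | x ∷ y ∷ _ | (x≺y ∷ _) ∷ _ | _ = inj₁ (y , x , [] , refl , there (here refl) ∷ here refl ∷ []
                                       , (x≺y ∷ []) ∷ [] ∷ [] , ([] ∷ []) , [] , tt)
    ... | x ∷ [] | _ | s≤s ()
    cups-caps (suc k) zero xs s ps le with xs | s | ℕₚ.≤-trans (at-least-two (suc k + 0)) le
    ... | x ∷ y ∷ _ | (x≺y ∷ _) ∷ _ | _ = inj₂ (x , y , [] , refl , here refl ∷ there (here refl) ∷ []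
                                       , (x≺y ∷ []) ∷ [] ∷ [] , ([] ∷ []) , [] , tt)
    ... | x ∷ [] | _ | s≤s ()
    cups-caps (suc k) (suc l) xs s ps le = decide (filter-pigeonhole end? xs (ℕₚ.m≤n⇒m≤1+n
      (ℕₚ.≤-trans (ℕₚ.≤-reflexive halves) le)))
      where
      halves : 2 ^ suc (suc k + l) + 2 ^ suc (k + suc l) ≡ 2 ^ suc (suc k + suc l)
      halves = subst (λ m → 2 ^ suc m + 2 ^ suc (k + suc l) ≡ 2 ^ suc (suc k + suc l)) (ℕₚ.+-suc k l)
        (cong (2 ^ suc (k + suc l) +_) (sym (ℕₚ.+-identityʳ _)))
      end? : Decidable (CupFrom k xs)
      end? x = em
      ends = filter end? xs
      decide : _ ⊎ _ → _
      decide (inj₁ le) with cups-caps (suc k) l ends (AllPairsₚ.filter⁺ end? s) (Allₚ.filter⁺ end? ps) le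
      ... | inj₁ (x , y , zs , len , zs∈ , cup) = inj₁ (x , y , zs , len , All-∈-filter⁻ end? xs zs∈ , cup)
      ... | inj₂ (x , v , ws , len , ws∈@(x∈E ∷ _) , sorted@((x≺v ∷ _) ∷ _) , cap)
          with ∈-filter⁻ end? {xs = xs} x∈E | All-∈-filter⁻ end? xs ws∈
      ...   | _ , y , zs , len′ , zs∈@(x∈ ∷ y∈ ∷ _) , sorted′@(zs≺x@(y≺x ∷ _) ∷ _) , cup | ws∈xs@(_ ∷ v∈ ∷ _)
            with T-total (All.lookup ps y∈) (All.lookup ps x∈) (All.lookup ps v∈) y≺x x≺v
      ...     | inj₁ yxv = inj₁ (v , x , y ∷ zs , cong suc len′ , v∈ ∷ zs∈
                , (x≺v ∷ All.map (λ z≺x → ≺-trans z≺x x≺v) zs≺x) ∷ sorted′ , Cups.AllTriples-cons yxv cup)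
      ...     | inj₂ yxv = inj₂ (y , x , v ∷ ws , cong suc len , y∈ ∷ ws∈xs
                , (y≺x ∷ All.map (≺-trans y≺x) (AllPairs.head sorted)) ∷ sorted , Caps.AllTriples-cons yxv cap)
      decide (inj₂ le)
          with cups-caps k (suc l) (filter (¬? ∘ end?) xs) (AllPairsₚ.filter⁺ (¬? ∘ end?) s) (Allₚ.filter⁺ (¬? ∘ end?) ps) le
      ... | inj₁ (x , y , zs , len , zs∈@(x∈ ∷ _) , cup) = contradiction
        (y , zs , len , All-∈-filter⁻ (¬? ∘ end?) xs zs∈ , cup) (proj₂ (∈-filter⁻ (¬? ∘ end?) {xs = xs} x∈))
      ... | inj₂ (x , y , zs , len , zs∈ , cap) = inj₂ (x , y , zs , len , All-∈-filter⁻ (¬? ∘ end?) xs zs∈ , cap)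

    homogeneous : ∀ n xs → Sorted xs → All P xs → 2 ^ suc (n + n) ≤ length xs →
      ∃[ zs ] (n ≤ length zs × All (_∈ xs) zs × Sorted zs ×
        ((∀ {a b c} → a ∈ zs → b ∈ zs → c ∈ zs → a ≺ b → b ≺ c → T⁺ a b c) ⊎
         (∀ {a b c} → a ∈ zs → b ∈ zs → c ∈ zs → a ≺ b → b ≺ c → T⁻ a b c)))
    homogeneous n xs s ps le with cups-caps n n xs s ps le
    ... | inj₂ (x , y , zs , refl , zs∈ , sorted , cap) =
      x ∷ y ∷ zs , ℕₚ.m≤n+m n 2 , zs∈ , sorted , inj₂ (Caps.AllTriples-lookup sorted cap)
    ... | inj₁ (x , y , zs , refl , zs∈ , sorted , cup) =
      reverse (x ∷ y ∷ zs)
      , ℕₚ.≤-trans (ℕₚ.m≤n+m n 2) (ℕₚ.≤-reflexive (sym (Listₚ.length-reverse (x ∷ y ∷ zs))))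
      , All.tabulate (λ z∈ → All.lookup zs∈ (Anyₚ.reverse⁻ z∈))
      , AllPairs-reverse sorted
      , inj₁ λ a∈ b∈ c∈ a≺b b≺c → Cups.AllTriples-lookup sorted cup
          (Anyₚ.reverse⁻ c∈) (Anyₚ.reverse⁻ b∈) (Anyₚ.reverse⁻ a∈) b≺c a≺b

-- The Erdős–Rado argument and its bounds

module Towers where

  open import Data.Nat.Base using (_+_; _*_; _^_; _≤_; _<_)
  open ≡ using (refl; cong; subst)
  open ℕₚ.≤-Reasoning

  1+n≤2^n : ∀ n → suc n ≤ 2 ^ n
  1+n≤2^n zero    = ℕₚ.≤-refl
  1+n≤2^n (suc n) = begin
    suc (suc n)    ≤⟨ s≤s (ℕₚ.m≤n+m (suc n) n) ⟩
    suc n + suc n  ≤⟨ ℕₚ.+-mono-≤ (1+n≤2^n n) (1+n≤2^n n) ⟩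
    2 ^ n + 2 ^ n  ≡⟨ cong (2 ^ n +_) (ℕₚ.+-identityʳ _) ⟨
    2 ^ suc n      ∎

  twr-positive : ∀ i {x} → 1 ≤ x → 1 ≤ twr (suc i) x
  twr-positive zero    1≤x = 1≤x
  twr-positive (suc i) {x} _ = ℕₚ.m^n>0 2 (twr (suc i) x)

  -- By `1 + e ≤ 2 ^ e` the factor becomes a summand `e` in the exponent, which `1 ≤ w` enlarges to
  -- `w * e`. The new exponent `w * suc e` is the same claim one level lower.
  twr-* : ∀ i {x} e → 1 ≤ x → twr (suc i) x * suc e ≤ twr (suc i) (suc e * x)
  twr-* zero    {x} e 1≤x = ℕₚ.≤-reflexive (ℕₚ.*-comm x (suc e))
  twr-* (suc i) {x} e 1≤x = begin
    2 ^ w * suc e      ≤⟨ ℕₚ.*-monoʳ-≤ (2 ^ w) (1+n≤2^n e) ⟩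
    2 ^ w * 2 ^ e      ≤⟨ ℕₚ.*-monoʳ-≤ (2 ^ w) (ℕₚ.^-monoʳ-≤ 2
                            (subst (_≤ w * e) (ℕₚ.*-identityˡ e) (ℕₚ.*-monoˡ-≤ e (twr-positive i 1≤x)))) ⟩
    2 ^ w * 2 ^ (w * e) ≡⟨ ℕₚ.^-distribˡ-+-* 2 w (w * e) ⟨
    2 ^ (w + w * e)    ≡⟨ cong (2 ^_) (ℕₚ.*-suc w e) ⟨
    2 ^ (w * suc e)    ≤⟨ ℕₚ.^-monoʳ-≤ 2 (twr-* i e 1≤x) ⟩
    2 ^ twr (suc i) (suc e * x) ∎
    where w = twr (suc i) x

  twr-^ : ∀ i {x} e → 1 ≤ x → twr (2 + i) x ^ suc e ≤ twr (2 + i) (suc e * x)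
  twr-^ i {x} e 1≤x = begin
    (2 ^ twr (suc i) x) ^ suc e  ≡⟨ ℕₚ.^-*-assoc 2 (twr (suc i) x) (suc e) ⟩
    2 ^ (twr (suc i) x * suc e)  ≤⟨ ℕₚ.^-monoʳ-≤ 2 (twr-* i e 1≤x) ⟩
    2 ^ twr (suc i) (suc e * x)  ∎

  x*[1+x^m]≤x^[2+m] : ∀ {x} m → 2 ≤ x → x * suc (x ^ m) ≤ x ^ (2 + m)
  x*[1+x^m]≤x^[2+m] {suc x} m 2≤x = ℕₚ.*-monoʳ-≤ (suc x) (begin
    suc (suc x ^ m)            ≤⟨ ℕₚ.+-monoˡ-≤ (suc x ^ m) (ℕₚ.m^n>0 (suc x) m) ⟩
    suc x ^ m + suc x ^ m      ≡⟨ cong (suc x ^ m +_) (ℕₚ.+-identityʳ _) ⟨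
    2 * suc x ^ m              ≤⟨ ℕₚ.*-monoˡ-≤ (suc x ^ m) 2≤x ⟩
    suc x * suc x ^ m          ∎)

  -- Two points for `o` and `w`, and twice `l * l + 1`, so that after halving by the sign of
  -- `⟨ o , w , x ⟩` more than `l * l` points remain for a monotone chain.
  planarSize : ℕ → ℕ
  planarSize l = 2 + (suc (l * l) + suc (l * l))

  -- With `l = 2 ^ (2 n + 1)` the size is at most `4 l ^ 2 = 2 ^ (4 n + 4)`, and `4 ≤ 4 n` gives the
  -- constant eight.
  planarSize≤ : ∀ {n} → 1 ≤ n → planarSize (2 ^ suc (n + n)) ≤ 2 ^ (8 * n)
  planarSize≤ {n} 1≤n = begin
    2 + (suc (l * l) + suc (l * l))        ≡⟨ solve 1 (λ s →
      con 2 :+ ((con 1 :+ s) :+ (con 1 :+ s)) := con 4 :+ (s :+ s)) refl (l * l) ⟩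
    4 + (l * l + l * l)                    ≤⟨ ℕₚ.+-monoˡ-≤ (l * l + l * l) (ℕₚ.*-mono-≤ 2≤l 2≤l) ⟩
    l * l + (l * l + l * l)                ≤⟨ ℕₚ.+-monoʳ-≤ (l * l) (ℕₚ.+-monoʳ-≤ (l * l) (ℕₚ.m≤m+n (l * l) (l * l))) ⟩
    l * l + (l * l + (l * l + l * l))      ≡⟨ solve 1 (λ s → s :+ (s :+ (s :+ s)) := con 4 :* s) refl (l * l) ⟩
    4 * (l * l)                            ≡⟨ cong (4 *_) (ℕₚ.^-distribˡ-+-* 2 (suc (n + n)) (suc (n + n))) ⟨
    2 ^ 2 * 2 ^ (suc (n + n) + suc (n + n)) ≡⟨ ℕₚ.^-distribˡ-+-* 2 2 (suc (n + n) + suc (n + n)) ⟨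
    2 ^ (2 + (suc (n + n) + suc (n + n)))  ≡⟨ cong (2 ^_) (solve 1 (λ n →
      con 2 :+ ((con 1 :+ (n :+ n)) :+ (con 1 :+ (n :+ n))) := con 4 :* con 1 :+ con 4 :* n) refl n) ⟩
    2 ^ (4 * 1 + 4 * n)                    ≤⟨ ℕₚ.^-monoʳ-≤ 2 (ℕₚ.+-monoˡ-≤ (4 * n) (ℕₚ.*-monoʳ-≤ 4 1≤n)) ⟩
    2 ^ (4 * n + 4 * n)                    ≡⟨ cong (2 ^_) (solve 1 (λ n → con 4 :* n :+ con 4 :* n := con 8 :* n) refl n) ⟩
    2 ^ (8 * n)                            ∎
    where
    open Data.Nat.Solver.+-*-Solver
    l = 2 ^ suc (n + n)
    2≤l : 2 ≤ l
    2≤l = ℕₚ.^-monoʳ-≤ 2 {1} {suc (n + n)} (s≤s z≤n)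

  -- The number of points from which tuples of length `3 + k` are reduced to triples on `M` points.
  -- The exponent is the price in `erdős-rado` of selecting `t = iterated k M` points when prefixes
  -- have length `3 + k`.
  iterated : ℕ → ℕ → ℕ
  iterated zero    M = M
  iterated (suc k) M = 2 ^ (iterated k M * suc (iterated k M ^ (3 + k)))

  iterated≤twr : ∀ k → ∃[ c ] (0 < c × ∀ n → 1 ≤ n →
    iterated k (planarSize (2 ^ suc (n + n))) ≤ twr (2 + k) (c * n))
  iterated≤twr zero = 8 , s≤s z≤n , λ n → planarSize≤ {n}
  iterated≤twr (suc k) with iterated≤twr k
  -- The new exponent is at most `y * suc (y ^ (3 + k)) ≤ y ^ (5 + k)`, and a power of a tower of
  -- height at least two only multiplies its argument.
  ... | c , 0<c , bound = (5 + k) * c , ℕₚ.*-mono-≤ {1} {5 + k} (s≤s z≤n) 0<c , λ n 1≤n →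
    let x = iterated k (planarSize (2 ^ suc (n + n)))
        y = twr (2 + k) (c * n)
        1≤cn = ℕₚ.*-mono-≤ 0<c 1≤n
    in ℕₚ.^-monoʳ-≤ 2 (begin
      x * suc (x ^ (3 + k))              ≤⟨ ℕₚ.*-mono-≤ (bound n 1≤n) (s≤s (ℕₚ.^-monoˡ-≤ (3 + k) (bound n 1≤n))) ⟩
      y * suc (y ^ (3 + k))              ≤⟨ x*[1+x^m]≤x^[2+m] (3 + k) (ℕₚ.^-monoʳ-≤ 2 {1} (twr-positive k 1≤cn)) ⟩
      y ^ (5 + k)                        ≤⟨ twr-^ k (4 + k) 1≤cn ⟩
      twr (2 + k) ((5 + k) * (c * n))    ≡⟨ cong (twr (2 + k)) (ℕₚ.*-assoc (5 + k) c n) ⟨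
      twr (2 + k) ((5 + k) * c * n)      ∎)

-- Greedy selection and the reduction to triples

module ErdősRado {A : Set} (_≺_ : Rel A 0ℓ) (≺-trans : Transitive _≺_) (≺-irrefl : ∀ {x} → ¬ (x ≺ x)) where

  open import Data.Nat.Base using (_+_; _*_; _^_; _≤_; _<_)
  open ≡ using (refl; sym; trans; cong; cong₂; subst)
  open Lists
  open Towers using (iterated)
  open Ordered _≺_ ≺-trans ≺-irrefl

  tuples : ∀ m → List A → List (Vec A m)
  tuples zero    qs = [] ∷ []
  tuples (suc m) qs = cartesianProductWith _∷_ qs (tuples m qs)

  ∈-tuples : ∀ {m qs} {zs : Vec A m} → VecAll (_∈ qs) zs → zs ∈ tuples m qs
  ∈-tuples []         = here refl
  ∈-tuples (z∈ ∷ zs∈) = ∈-cartesianProductWith⁺ _∷_ z∈ (∈-tuples zs∈)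

  length-tuples : ∀ m qs → length (tuples m qs) ≡ length qs ^ m
  length-tuples zero    qs = refl
  length-tuples (suc m) qs =
    trans (length-product qs (tuples m qs)) (cong (length qs *_) (length-tuples m qs))
    where
    length-product : ∀ xs (ys : List (Vec A m)) → length (cartesianProductWith _∷_ xs ys) ≡ length xs * length ys
    length-product []       ys = refl
    length-product (x ∷ xs) ys = trans (Listₚ.length-++ (map (x ∷_) ys))
      (cong₂ _+_ (Listₚ.length-map (x ∷_) ys) (length-product xs ys))

  -- Each test keeps at least half of the remaining elements on which it is constant, hence one
  -- factor two per test.
  make-constant : ∀ (ts : List (A → Sign)) xs {n} → Sorted xs → 2 ^ length ts * n ≤ length xs →
    ∃[ ys ] (n ≤ length ys × Sorted ys × All (_∈ xs) ys × All (λ t → Constant t ys) ts)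
  make-constant []       xs {n} s le =
    xs , subst (_≤ length xs) (ℕₚ.+-identityʳ n) le , s , All.tabulate id , []
  make-constant (t ∷ ts) xs {n} s le with constant-half t xs {2 ^ length ts * n}
    (subst (_≤ length xs) (trans (ℕₚ.*-assoc 2 (2 ^ length ts) n)
      (cong (2 ^ length ts * n +_) (ℕₚ.+-identityʳ _))) le)
  ... | σ , le′ with make-constant ts (filter t≡σ? xs) (AllPairsₚ.filter⁺ t≡σ? s) le′
    where t≡σ? = λ x → t x Signₚ.≟ σ
  ... | ys , n≤ , sorted , ys∈ , constant =
    ys , n≤ , sorted , All-∈-filter⁻ t≡σ? xs ys∈
    , (σ , All.map (proj₂ ∘ ∈-filter⁻ t≡σ? {xs = xs}) ys∈) ∷ constant
    where t≡σ? = λ x → t x Signₚ.≟ σ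

  Constant⇒≡ : ∀ {t : A → Sign} {xs : List A} → Constant t xs → ∀ {a b} → a ∈ xs → b ∈ xs → t a ≡ t b
  Constant⇒≡ (_ , eqs) a∈ b∈ = trans (All.lookup eqs a∈) (sym (All.lookup eqs b∈))

  module _ {m} (χ : Vec A (suc m) → Sign) where

    Insensitive : List A → List A → Set
    Insensitive qs cs = ∀ zs → VecAll (_∈ qs) zs → ∀ {a b} → a ∈ cs → b ∈ cs → χ (zs ∷ʳ a) ≡ χ (zs ∷ʳ b)

    tests : List A → List (A → Sign)
    tests qs = map (λ zs a → χ (zs ∷ʳ a)) (tuples m qs)

    -- qs are the points already chosen and cs the candidates for the next ones.
    greedy : ∀ N t qs cs → length qs + t ≤ N → 2 ^ (t * suc (N ^ m)) ≤ length cs →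
      Sorted cs → Insensitive qs cs →
      ∃[ rs ] ∃[ w ] (length rs ≡ t × All (_∈ cs) rs × w ∈ cs × Sorted rs × All (_≺ w) rs ×
        (∀ zs {a} → VecAll (λ z → z ∈ qs ⊎ (z ∈ rs × z ≺ a)) zs → a ∈ rs → χ (zs ∷ʳ a) ≡ χ (zs ∷ʳ w)))
    greedy N zero qs (w ∷ cs) _ _ _ _ = [] , w , refl , [] , here refl , [] , [] , λ _ _ ()
    greedy N (suc t) qs [] _ le _ _ = contradiction le (ℕₚ.<⇒≱ (ℕₚ.m^n>0 2 (suc t * suc (N ^ m))))
    greedy N (suc t) qs (c ∷ cs) len le (c≺ ∷ s) insensitive
      with make-constant (tests (c ∷ qs)) cs {2 ^ (t * suc (N ^ m))} s enough
      where
      M = 2 ^ (t * suc (N ^ m))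
      K = N ^ m
      open ℕₚ.≤-Reasoning
      tests≤ : length (tests (c ∷ qs)) ≤ K
      tests≤ = begin
        length (tests (c ∷ qs))     ≡⟨ Listₚ.length-map _ (tuples m (c ∷ qs)) ⟩
        length (tuples m (c ∷ qs))  ≡⟨ length-tuples m (c ∷ qs) ⟩
        suc (length qs) ^ m         ≤⟨ ℕₚ.^-monoˡ-≤ m (ℕₚ.≤-trans (s≤s (ℕₚ.m≤m+n (length qs) t))
                                         (ℕₚ.≤-trans (ℕₚ.≤-reflexive (sym (ℕₚ.+-suc (length qs) t))) len)) ⟩
        N ^ m                       ∎
      -- There are at most `K` prefixes over the chosen points, each halving the candidates. The
      -- successor in `suc K` is a further factor two, which pays for the candidate `c` that is
      -- removed.
      enough : 2 ^ length (tests (c ∷ qs)) * M ≤ length cs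
      enough = ℕₚ.≤-pred (begin
        suc (2 ^ length (tests (c ∷ qs)) * M)
          ≤⟨ s≤s (ℕₚ.*-monoˡ-≤ M (ℕₚ.^-monoʳ-≤ 2 tests≤)) ⟩
        suc (2 ^ K * M)              ≤⟨ ℕₚ.+-monoˡ-≤ (2 ^ K * M) (ℕₚ.*-mono-≤ (ℕₚ.m^n>0 2 K) (ℕₚ.m^n>0 2 (t * suc K))) ⟩
        2 ^ K * M + 2 ^ K * M        ≡⟨ cong (2 ^ K * M +_) (ℕₚ.+-identityʳ _) ⟨
        2 * (2 ^ K * M)              ≡⟨ ℕₚ.*-assoc 2 (2 ^ K) M ⟨
        2 ^ suc K * M                ≡⟨ ℕₚ.^-distribˡ-+-* 2 (suc K) (t * suc K) ⟨
        2 ^ (suc t * suc K)          ≤⟨ le ⟩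
        suc (length cs)              ∎)
    ... | ds , M≤ , sorted , ds∈ , constant
      with greedy N t (c ∷ qs) ds (subst (_≤ N) (ℕₚ.+-suc (length qs) t) len) M≤ sorted
             (λ zs zs∈ → Constant⇒≡ (All.lookup constant (∈-map⁺ (λ zs a → χ (zs ∷ʳ a)) (∈-tuples zs∈))))
    ... | rs , w , len-rs , rs∈ , w∈ , sorted-rs , rs≺w , insensitive′ =
      c ∷ rs , w , cong suc len-rs , here refl ∷ All.map (there ∘ All.lookup ds∈) rs∈
      , there w∈cs , c≺rs ∷ sorted-rs , All.lookup c≺ w∈cs ∷ rs≺w , result
      where
      w∈cs = All.lookup ds∈ w∈
      c≺rs : All (c ≺_) rs
      c≺rs = All.map (All.lookup c≺ ∘ All.lookup ds∈) rs∈
      result : ∀ zs {a} → VecAll (λ z → z ∈ qs ⊎ (z ∈ c ∷ rs × z ≺ a)) zs → a ∈ c ∷ rs →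
               χ (zs ∷ʳ a) ≡ χ (zs ∷ʳ w)
      -- Nothing in `c ∷ rs` precedes `c`, so the prefix lies in `qs`; both `c` and `w` were
      -- candidates when insensitivity over `qs` was established.
      result zs zs∈ (here refl) = insensitive zs (VecAll.map in-qs zs∈) (here refl) (there w∈cs)
        where
        in-qs : ∀ {z} → z ∈ qs ⊎ (z ∈ c ∷ rs × z ≺ c) → z ∈ qs
        in-qs (inj₁ z∈)                = z∈
        in-qs (inj₂ (here refl , c≺c)) = contradiction c≺c ≺-irrefl
        in-qs (inj₂ (there z∈ , z≺c))  = contradiction (≺-trans (All.lookup c≺rs z∈) z≺c) ≺-irrefl
      result zs zs∈ (there a∈) = insensitive′ zs (VecAll.map shift zs∈) a∈
        where
        shift : ∀ {z a} → z ∈ qs ⊎ (z ∈ c ∷ rs × z ≺ a) → z ∈ c ∷ qs ⊎ (z ∈ rs × z ≺ a)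
        shift (inj₁ z∈)               = inj₁ (there z∈)
        shift (inj₂ (here refl , _))  = inj₁ (here refl)
        shift (inj₂ (there z∈ , z≺a)) = inj₂ (z∈ , z≺a)

  erdős-rado : ∀ {m} (χ : Vec A (suc (suc m)) → Sign) t xs → Sorted xs →
    2 ^ (t * suc (t ^ suc m)) ≤ length xs →
    ∃[ rs ] ∃[ w ] (length rs ≡ t × All (_∈ xs) rs × w ∈ xs × Sorted rs × All (_≺ w) rs ×
      (∀ zs {a} → VecAll (λ z → z ∈ rs × z ≺ a) zs → a ∈ rs → χ (zs ∷ʳ a) ≡ χ (zs ∷ʳ w)))
  -- A nonempty prefix has no members in the empty list, so insensitivity holds vacuously at the
  -- start; hence tuples of length at least two.
  erdős-rado χ t xs s le with greedy χ t t [] xs ℕₚ.≤-refl le s (λ { (z ∷ zs) (() ∷ _) })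
  ... | rs , w , len , rs∈ , w∈ , sorted , rs≺w , insensitive =
    rs , w , len , rs∈ , w∈ , sorted , rs≺w , λ zs zs∈ → insensitive zs (VecAll.map inj₂ zs∈)

  VecAll-∷ʳ⁺ : ∀ {P : A → Set} {n} {xs : Vec A n} {x} → VecAll P xs → P x → VecAll P (xs ∷ʳ x)
  VecAll-∷ʳ⁺ []         px′ = px′ ∷ []
  VecAll-∷ʳ⁺ (px ∷ pxs) px′ = px ∷ VecAll-∷ʳ⁺ pxs px′

  VecAll-∷ʳ⁻ : ∀ {P : A → Set} {n} (xs : Vec A n) {x} → VecAll P (xs ∷ʳ x) → VecAll P xs × P x
  VecAll-∷ʳ⁻ []       (px ∷ [])  = [] , px
  VecAll-∷ʳ⁻ (_ ∷ xs) (px ∷ pxs) = let pxs′ , px′ = VecAll-∷ʳ⁻ xs pxs in px ∷ pxs′ , px′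

  VecAllPairs-∷ʳ⁺ : ∀ {n} {xs : Vec A n} {x} → VecAllPairs _≺_ xs → VecAll (_≺ x) xs → VecAllPairs _≺_ (xs ∷ʳ x)
  VecAllPairs-∷ʳ⁺ []       []        = [] ∷ []
  VecAllPairs-∷ʳ⁺ (p ∷ ps) (q ∷ qs) = VecAll-∷ʳ⁺ p q ∷ VecAllPairs-∷ʳ⁺ ps qs

  VecAllPairs-∷ʳ⁻ : ∀ {n} (xs : Vec A n) {x} → VecAllPairs _≺_ (xs ∷ʳ x) → VecAllPairs _≺_ xs × VecAll (_≺ x) xs
  VecAllPairs-∷ʳ⁻ []       _        = [] , []
  VecAllPairs-∷ʳ⁻ (_ ∷ xs) (p ∷ ps) =
    let p′ , q = VecAll-∷ʳ⁻ xs p ; ps′ , qs = VecAllPairs-∷ʳ⁻ xs ps in p′ ∷ ps′ , q ∷ qs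

  -- Freezing `w` as last argument leaves a colouring of tuples one shorter, to be reduced on `rs`.
  -- As `rs` precedes `w`, appending `w` keeps `ws` increasing and behind `ys`. Thus
  -- `a ∷ b ∷ c ∷ ws` is an increasing tuple whenever `a ≺ b ≺ c` in `ys`, which later makes its
  -- determinant nonzero.
  reduce-to-triples : ∀ k (χ : Vec A (3 + k) → Sign) M xs → Sorted xs → iterated k M ≤ length xs →
    ∃[ ys ] Σ (Vec A k) λ ws →
      M ≤ length ys × All (_∈ xs) ys × Sorted ys ×
      VecAll (_∈ xs) ws × VecAllPairs _≺_ ws × All (λ y → VecAll (y ≺_) ws) ys ×
      (∀ a b c us → VecAll (_∈ ys) (a ∷ b ∷ c ∷ us) → VecAllPairs _≺_ (a ∷ b ∷ c ∷ us) →
        χ (a ∷ b ∷ c ∷ us) ≡ χ (a ∷ b ∷ c ∷ ws))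
  reduce-to-triples zero χ M xs s le =
    xs , [] , le , All.tabulate id , s , [] , [] , All.tabulate (λ _ → []) , λ { a b c [] _ _ → refl }
  reduce-to-triples (suc k) χ M xs s le with erdős-rado χ (iterated k M) xs s le
  ... | rs , w , len , rs∈ , w∈ , sorted-rs , rs≺w , insensitive
    with reduce-to-triples k (λ zs → χ (zs ∷ʳ w)) M rs sorted-rs (ℕₚ.≤-reflexive (sym len))
  ... | ys , ws , M≤ , ys∈ , sorted , ws∈ , sorted-ws , ys≺ws , eq =
    ys , ws ∷ʳ w , M≤ , All.map (All.lookup rs∈) ys∈ , sorted
    , VecAll-∷ʳ⁺ (VecAll.map (All.lookup rs∈) ws∈) w∈
    , VecAllPairs-∷ʳ⁺ sorted-ws (VecAll.map (All.lookup rs≺w) ws∈)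
    , All.zipWith (λ (y≺ws , y≺w) → VecAll-∷ʳ⁺ y≺ws y≺w) (ys≺ws , All.map (All.lookup rs≺w) ys∈)
    , result
    where
    result : ∀ a b c us → VecAll (_∈ ys) (a ∷ b ∷ c ∷ us) → VecAllPairs _≺_ (a ∷ b ∷ c ∷ us) →
             χ (a ∷ b ∷ c ∷ us) ≡ χ (a ∷ b ∷ c ∷ (ws ∷ʳ w))
    result a b c us us∈ us-sorted with Vec.initLast us
    ... | us′ , u , refl =
      let us′∈ , u∈ = VecAll-∷ʳ⁻ (a ∷ b ∷ c ∷ us′) us∈
          us′-sorted , us′≺u = VecAllPairs-∷ʳ⁻ (a ∷ b ∷ c ∷ us′) us-sorted
      in trans (insensitive (a ∷ b ∷ c ∷ us′)
                 (VecAll.map (λ (z∈ , z≺u) → All.lookup ys∈ z∈ , z≺u) (VecAll.zip (us′∈ , us′≺u))) (All.lookup ys∈ u∈))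
               (eq a b c us′ us′∈ us′-sorted)

-- Configurations over an ordered ring

module Indexing {A : Set} {R : Rel A 0ℓ} where

  VecAllPairs-lookup : ∀ {n} {xs : Vec A n} → VecAllPairs R xs →
    ∀ {i j} → i Fin.< j → R (lookup xs i) (lookup xs j)
  VecAllPairs-lookup (r ∷ rs) {zero}  {suc j} _         = VecAllₚ.lookup⁺ r j
  VecAllPairs-lookup (r ∷ rs) {suc i} {suc j} (s≤s i<j) = VecAllPairs-lookup rs i<j

  VecAllPairs-tabulate : ∀ {n} (f : Fin n → A) →
    (∀ {i j} → i Fin.< j → R (f i) (f j)) → VecAllPairs R (tabulate f)
  VecAllPairs-tabulate {ℕ.zero} f inc = []
  VecAllPairs-tabulate {suc n}  f inc =
    VecAllₚ.tabulate⁺ (λ i → inc (s≤s z≤n)) ∷ VecAllPairs-tabulate (f ∘ suc) (inc ∘ s≤s)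

  AllPairs-lookup-< : ∀ {xs : List A} → AllPairs R xs →
    ∀ {i j} → i Fin.< j → R (List.lookup xs i) (List.lookup xs j)
  AllPairs-lookup-< {_ ∷ xs} (r ∷ rs) {zero}  {suc j} _         = All.lookup r (∈-lookup j)
  AllPairs-lookup-< {_ ∷ xs} (r ∷ rs) {suc i} {suc j} (s≤s i<j) = AllPairs-lookup-< rs i<j

open Indexing

record PositiveCone (R : CommutativeRing 0ℓ 0ℓ) : Set₁ where
  open CommutativeRing R using (Carrier; _≈_; _+_; _*_; -_; 0#; 1#)
  field
    Positive         : Carrier → Set
    positive-resp-≈  : ∀ {x y} → x ≈ y → Positive x → Positive y
    positive-+       : ∀ {x y} → Positive x → Positive y → Positive (x + y)
    positive-*       : ∀ {x y} → Positive x → Positive y → Positive (x * y)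
    0-not-positive   : ¬ Positive 0#
    1-positive       : Positive 1#
    trichotomy       : ∀ x → x ≈ 0# ⊎ Positive x ⊎ Positive (- x)

module OrderedRing (R : CommutativeRing 0ℓ 0ℓ) (cone : PositiveCone R) where

  open CommutativeRing R hiding (zero)
  open PositiveCone cone
  open Algebra.Properties.Ring ring
  open Determinants R
  open Algebra.Properties.Semiring.Exp semiring using (_^_)
  open Defs.LinearAlgebra rawRing using (det; dot)
  open Towers using (iterated; planarSize)
  open Relation.Binary.Reasoning.Setoid setoid

  -- Rules of signs

  signed : Sign → Carrier → Carrier
  signed Sign.+ x = x
  signed Sign.- x = - x

  HasSign : Sign → Carrier → Set
  HasSign s x = Positive (signed s x)

  sign-resp-≈ : ∀ s {x y} → x ≈ y → HasSign s x → HasSign s y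
  sign-resp-≈ Sign.+ x≈y = positive-resp-≈ x≈y
  sign-resp-≈ Sign.- x≈y = positive-resp-≈ (-‿cong x≈y)

  sign-+ : ∀ s {x y} → HasSign s x → HasSign s y → HasSign s (x + y)
  sign-+ Sign.+         = positive-+
  sign-+ Sign.- {x} {y} = λ p q → positive-resp-≈ (-‿+-comm x y) (positive-+ p q)

  -x*-y≈x*y : ∀ x y → - x * - y ≈ x * y
  -x*-y≈x*y x y = begin
    - x * - y      ≈⟨ -‿distribˡ-* x (- y) ⟨
    - (x * - y)    ≈⟨ -‿cong (-‿distribʳ-* x y) ⟨
    - - (x * y)    ≈⟨ -‿involutive _ ⟩
    x * y          ∎

  sign-* : ∀ s t {x y} → HasSign s x → HasSign t y → HasSign (s Sign.* t) (x * y)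
  sign-* Sign.+ Sign.+ p q = positive-* p q
  sign-* Sign.+ Sign.- p q = positive-resp-≈ (sym (-‿distribʳ-* _ _)) (positive-* p q)
  sign-* Sign.- Sign.+ p q = positive-resp-≈ (sym (-‿distribˡ-* _ _)) (positive-* p q)
  sign-* Sign.- Sign.- p q = positive-resp-≈ (-x*-y≈x*y _ _) (positive-* p q)

  sign⇒≉0 : ∀ s {x} → HasSign s x → ¬ (x ≈ 0#)
  sign⇒≉0 Sign.+ p x≈0 = 0-not-positive (positive-resp-≈ x≈0 p)
  sign⇒≉0 Sign.- p x≈0 = 0-not-positive (positive-resp-≈ (trans (-‿cong x≈0) -0#≈0#) p)

  sign-unique : ∀ s t {x} → HasSign s x → HasSign t x → s ≡ t
  sign-unique Sign.+ Sign.+ _ _ = ≡.refl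
  sign-unique Sign.- Sign.- _ _ = ≡.refl
  sign-unique Sign.+ Sign.- p q = contradiction (positive-resp-≈ (-‿inverseʳ _) (positive-+ p q)) 0-not-positive
  sign-unique Sign.- Sign.+ p q = contradiction (positive-resp-≈ (-‿inverseʳ _) (positive-+ q p)) 0-not-positive

  -- Junk value: the sign of zero is +.
  sign : Carrier → Sign
  sign x with trichotomy x
  ... | inj₁ _        = Sign.+
  ... | inj₂ (inj₁ _) = Sign.+
  ... | inj₂ (inj₂ _) = Sign.-

  sign-correct : ∀ {x} → ¬ (x ≈ 0#) → HasSign (sign x) x
  sign-correct {x} x≉0 with trichotomy x
  ... | inj₁ x≈0      = contradiction x≈0 x≉0
  ... | inj₂ (inj₁ p) = p
  ... | inj₂ (inj₂ p) = p

  x≈0? : ∀ x → Dec (x ≈ 0#)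
  x≈0? x with trichotomy x
  ... | inj₁ x≈0      = yes x≈0
  ... | inj₂ (inj₁ p) = no (sign⇒≉0 Sign.+ p)
  ... | inj₂ (inj₂ p) = no (sign⇒≉0 Sign.- p)

  no-zero-divisors : ∀ {x y} → x * y ≈ 0# → ¬ (x ≈ 0#) → y ≈ 0#
  no-zero-divisors {x} {y} xy≈0 x≉0 with x≈0? y
  ... | yes y≈0 = y≈0
  ... | no y≉0  = contradiction xy≈0
    (sign⇒≉0 (sign x Sign.* sign y) (sign-* (sign x) (sign y) (sign-correct x≉0) (sign-correct y≉0)))

  x≈-x⇒x≈0 : ∀ {x} → x ≈ - x → x ≈ 0#
  x≈-x⇒x≈0 {x} x≈-x with x≈0? x
  ... | yes x≈0 = x≈0
  ... | no x≉0  = contradiction (trans (+-congˡ x≈-x) (-‿inverseʳ x))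
    (sign⇒≉0 (sign x) (sign-+ (sign x) (sign-correct x≉0) (sign-correct x≉0)))

  -- The transitivity of the colourings is read off from Plücker relations of this shape.
  three-term-sign : ∀ {p x q y r z} σ τ → p * x ≈ q * y + r * z →
    HasSign σ p → HasSign σ q → HasSign σ r → HasSign τ y → HasSign τ z → HasSign τ x
  three-term-sign {p} {x} σ τ eq hp hq hr hy hz =
    ≡.subst (λ s → HasSign s x)
      (Signₚ.*-cancelˡ-≡ σ (sign x) τ (sign-unique (σ Sign.* sign x) (σ Sign.* τ) (sign-* σ (sign x) hp hx) hpx)) hx
    where
    hpx = sign-resp-≈ (σ Sign.* τ) (sym eq) (sign-+ (σ Sign.* τ) (sign-* σ τ hq hy) (sign-* σ τ hr hz))
    hx : HasSign (sign x) x
    hx = sign-correct λ x≈0 → sign⇒≉0 (σ Sign.* τ) hpx (trans (*-congˡ x≈0) (zeroʳ p))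

  open OverDomain (sign⇒≉0 Sign.+ 1-positive) x≈0? no-zero-divisors x≈-x⇒x≈0 public

  -- Brackets and the three-term Plücker relations

  module Bracket {k} (W : Fin k → Vector Carrier (3 ℕ.+ k)) where

    private
      V : Set
      V = Vector Carrier (3 ℕ.+ k)

    columns : V → V → V → Matrix (3 ℕ.+ k)
    columns x y z i zero                = x i
    columns x y z i (suc zero)          = y i
    columns x y z i (suc (suc zero))    = z i
    columns x y z i (suc (suc (suc j))) = W j i

    bracket : V → V → V → Carrier
    bracket x y z = det (columns x y z)

    swap₀₁ : ∀ x y z → bracket y x z ≈ - bracket x y z
    swap₀₁ x y z = trans (det-cong exchanged) (det-swap zero (columns x y z))
      where
      exchanged : ∀ i j → columns y x z i j ≈ columns x y z i (swap zero j)
      exchanged i zero                = refl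
      exchanged i (suc zero)          = refl
      exchanged i (suc (suc zero))    = refl
      exchanged i (suc (suc (suc j))) = refl

    swap₁₂ : ∀ x y z → bracket x z y ≈ - bracket x y z
    swap₁₂ x y z = trans (det-cong exchanged) (det-swap (suc zero) (columns x y z))
      where
      exchanged : ∀ i j → columns x z y i j ≈ columns x y z i (swap (suc zero) j)
      exchanged i zero                = refl
      exchanged i (suc zero)          = refl
      exchanged i (suc (suc zero))    = refl
      exchanged i (suc (suc (suc j))) = refl

    rotate : ∀ x y z → bracket z x y ≈ bracket x y z
    rotate x y z = begin
      bracket z x y      ≈⟨ swap₀₁ x z y ⟩
      - bracket x z y    ≈⟨ -‿cong (swap₁₂ x y z) ⟩
      - - bracket x y z  ≈⟨ -‿involutive _ ⟩
      bracket x y z      ∎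

    bracket-linear : ∀ x y → Linear (bracket x y)
    bracket-linear x y = linear-resp
      (λ u → det-cong (replace-unique {A = columns x y x} (λ _ → refl) (unchanged u)))
      (det-linear (columns x y x) (suc (suc zero)))
      where
      unchanged : ∀ u i j → j ≢ suc (suc zero) → columns x y u i j ≈ columns x y x i j
      unchanged u i zero                _   = refl
      unchanged u i (suc zero)          _   = refl
      unchanged u i (suc (suc zero))    j≢2 = contradiction ≡.refl j≢2
      unchanged u i (suc (suc (suc j))) _   = refl

    bracket-x : ∀ x y → bracket x y x ≈ 0#
    bracket-x x y = det-equal-columns (columns x y x) zero (suc (suc zero)) (λ ()) λ _ → refl

    bracket-y : ∀ x y → bracket x y y ≈ 0#
    bracket-y x y = det-equal-columns (columns x y y) (suc zero) (suc (suc zero)) (λ ()) λ _ → refl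

    bracket-W : ∀ x y j → bracket x y (W j) ≈ 0#
    bracket-W x y j = det-equal-columns (columns x y (W j)) (suc (suc zero)) (suc (suc (suc j))) (λ ()) λ _ → refl

    -- The difference of the two sides is linear in e and vanishes on the basis a, c, d, W.
    plücker : ∀ a b c d e → ¬ (bracket a c d ≈ 0#) →
      bracket a b d * bracket a c e ≈ bracket a b c * bracket a d e + bracket a b e * bracket a c d
    plücker a b c d e acd≉0 = x∙y⁻¹≈ε⇒x≈y _ _ (trans (proj₂ ψ-linear e)
      (trans (dot-cong {u = e} coefficients≈0 (λ _ → refl)) (dot-0ˡ e)))
      where
      ψ : V → Carrier
      ψ u = bracket a b d * bracket a c u
          + - (bracket a b c * bracket a d u + bracket a b u * bracket a c d)
      ψ-linear : Linear ψ
      ψ-linear = linear-+ (linear-* _ (bracket-linear a c)) (linear-neg (linear-+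
        (linear-* _ (bracket-linear a d))
        (linear-resp (λ u → *-comm _ _) (linear-* (bracket a c d) (bracket-linear a b)))))
      vanish : ∀ {u x y z} → bracket a c u ≈ 0# → bracket a d u ≈ 0# → bracket a b u ≈ 0# →
               x * bracket a c u + - (y * bracket a d u + bracket a b u * z) ≈ 0#
      vanish {u} {x} {y} {z} acu adu abu = begin
        x * bracket a c u + - (y * bracket a d u + bracket a b u * z)
          ≈⟨ +-cong (trans (*-congˡ acu) (zeroʳ x)) (-‿cong (+-cong
               (trans (*-congˡ adu) (zeroʳ y)) (trans (*-congʳ abu) (zeroˡ z)))) ⟩
        0# + - (0# + 0#)  ≈⟨ +-identityˡ _ ⟩
        - (0# + 0#)       ≈⟨ -‿cong (+-identityʳ 0#) ⟩
        - 0#              ≈⟨ -0#≈0# ⟩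
        0#                ∎
      ψ-basis : ∀ j → ψ (λ i → columns a c d i j) ≈ 0#
      ψ-basis zero = vanish {a} (bracket-x a c) (bracket-x a d) (bracket-x a b)
      ψ-basis (suc zero) = begin
        bracket a b d * bracket a c c + - (bracket a b c * bracket a d c + bracket a b c * bracket a c d)
          ≈⟨ +-cong (trans (*-congˡ (bracket-y a c)) (zeroʳ _)) (-‿cong (sym (distribˡ _ _ _))) ⟩
        0# + - (bracket a b c * (bracket a d c + bracket a c d))
          ≈⟨ +-congˡ (-‿cong (*-congˡ (trans (+-congʳ (swap₁₂ a c d)) (-‿inverseˡ _)))) ⟩
        0# + - (bracket a b c * 0#)  ≈⟨ +-identityˡ _ ⟩
        - (bracket a b c * 0#)       ≈⟨ -‿cong (zeroʳ _) ⟩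
        - 0#                         ≈⟨ -0#≈0# ⟩
        0#                           ∎
      ψ-basis (suc (suc zero)) = begin
        bracket a b d * bracket a c d + - (bracket a b c * bracket a d d + bracket a b d * bracket a c d)
          ≈⟨ +-congˡ (-‿cong (trans (+-congʳ (trans (*-congˡ (bracket-y a d)) (zeroʳ _))) (+-identityˡ _))) ⟩
        bracket a b d * bracket a c d + - (bracket a b d * bracket a c d)
          ≈⟨ -‿inverseʳ _ ⟩
        0# ∎
      ψ-basis (suc (suc (suc j))) = vanish {W j} (bracket-W a c j) (bracket-W a d j) (bracket-W a b j)
      coefficients≈0 : ∀ i → proj₁ ψ-linear i ≈ 0#
      coefficients≈0 = regular⇒kernel-trivial (columns a c d) acd≉0 (proj₁ ψ-linear) λ j →
        trans (sym (proj₂ ψ-linear _)) (ψ-basis j)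

    -- This is `plücker` based at `b`, rewritten with `o` first and the other arguments in order.
    -- The coefficients become brackets with `o`, whose sign is constant, so `three-term-sign`
    -- yields the colour of `a b d`.
    plücker-second : ∀ o a b c d → ¬ (bracket a b c ≈ 0#) →
      bracket o b c * bracket a b d ≈ bracket o a b * bracket b c d + bracket o b d * bracket a b c
    plücker-second o a b c d abc≉0 = begin
      bracket o b c * bracket a b d
        ≈⟨ -x*-y≈x*y _ _ ⟨
      - bracket o b c * - bracket a b d
        ≈⟨ *-cong (swap₀₁ o b c) (swap₀₁ a b d) ⟨
      bracket b o c * bracket b a d
        ≈⟨ plücker b o a c d bac≉0 ⟩
      bracket b o a * bracket b c d + bracket b o d * bracket b a c
        ≈⟨ +-cong (*-congʳ (rotate o a b)) (trans (*-cong (swap₀₁ o b d) (swap₀₁ a b c)) (-x*-y≈x*y _ _)) ⟩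
      bracket o a b * bracket b c d + bracket o b d * bracket a b c ∎
      where
      bac≉0 : ¬ (bracket b a c ≈ 0#)
      bac≉0 bac≈0 = abc≉0 (trans (swap₀₁ b a c) (trans (-‿cong bac≈0) -0#≈0#))

    -- The same relation based at `c`, for the colour of `a c d`. Restoring the order of arguments
    -- puts one minus sign into each of the three products, so the identity is proved negated.
    plücker-third : ∀ o a b c d → ¬ (bracket a b c ≈ 0#) →
      bracket o b c * bracket a c d ≈ bracket o a c * bracket b c d + bracket o c d * bracket a b c
    plücker-third o a b c d abc≉0 = -‿injective (begin
      - (bracket o b c * bracket a c d)
        ≈⟨ -‿distribʳ-* _ _ ⟩
      bracket o b c * - bracket a c d
        ≈⟨ *-cong (rotate o b c) (swap₀₁ a c d) ⟨
      bracket c o b * bracket c a d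
        ≈⟨ plücker c o a b d (abc≉0 ∘ trans (sym (rotate a b c))) ⟩
      bracket c o a * bracket c b d + bracket c o d * bracket c a b
        ≈⟨ +-cong (*-cong (rotate o a c) (swap₀₁ b c d)) (*-cong (swap₀₁ o c d) (rotate a b c)) ⟩
      bracket o a c * - bracket b c d + - bracket o c d * bracket a b c
        ≈⟨ +-cong (-‿distribʳ-* _ _) (-‿distribˡ-* _ _) ⟨
      - (bracket o a c * bracket b c d) + - (bracket o c d * bracket a b c)
        ≈⟨ -‿+-comm _ _ ⟩
      - (bracket o a c * bracket b c d + bracket o c d * bracket a b c) ∎)

  -- Homogeneous coordinates

  homogenize : ∀ {d} → Vector Carrier d → Vector Carrier (suc d)
  homogenize p zero    = 1#
  homogenize p (suc i) = p i

  -- Subtract the first column from all others and expand along the first row.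
  det-homogenize : ∀ {d} (p : Fin (suc d) → Vector Carrier d) →
    det (λ i j → homogenize (p j) i) ≈ det (λ i j → p (suc j) i + - p zero i)
  det-homogenize {d} p = begin
    det A                             ≈⟨ *-identityˡ _ ⟨
    1# * det A                        ≈⟨ *-congʳ (1^e≈1 (proj₁ det-eliminated)) ⟨
    1# ^ proj₁ det-eliminated * det A ≈⟨ proj₂ det-eliminated ⟨
    det eliminated                    ≈⟨ x+-0≈x (alternatingSum-0 {v = later} λ k →
                                           trans (*-congʳ (row≈0 k)) (zeroˡ (det (minor eliminated (suc k))))) ⟩
    1# * det (minor eliminated zero)  ≈⟨ *-identityˡ _ ⟩
    det (minor eliminated zero)       ≈⟨ det-cong {A = minor eliminated zero} (λ i j →
                                           +-cong (*-identityˡ (p (suc j) i)) (-1*x≈-x (p zero i))) ⟩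
    det (λ i j → p (suc j) i + - p zero i) ∎
    where
    A : Matrix (suc d)
    A i j = homogenize (p j) i
    open Elimination A zero 1# (const (- 1#))
    later : Vector Carrier d
    later k = eliminated zero (suc k) * det (minor eliminated (suc k))
    row≈0 : ∀ k → eliminated zero (suc k) ≈ 0#
    row≈0 k = trans (+-cong (*-identityˡ 1#) (-1*x≈-x 1#)) (-‿inverseʳ 1#)
    1^e≈1 : ∀ e → 1# ^ e ≈ 1#
    1^e≈1 ℕ.zero    = refl
    1^e≈1 (ℕ.suc e) = trans (*-identityˡ _) (1^e≈1 e)

  -- Homogeneous subsequences of vectors

  module Homogeneity
    (em : ExcludedMiddle 0ℓ)
    {k N} (v : Fin N → Vector Carrier (3 ℕ.+ k)) where

    Increasing : ∀ {n} → Vec (Fin N) n → Set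
    Increasing = VecAllPairs Fin._<_

    tupleDet : Vec (Fin N) (3 ℕ.+ k) → Carrier
    tupleDet us = det (λ i j → v (lookup us j) i)

    private
      <-trans = λ {x y z : Fin N} → Finₚ.<-trans {i = x} {y} {z}
      <-irrefl = λ {x : Fin N} → Finₚ.<-irrefl {x = x} ≡.refl

    open Lists
    open Ordered (Fin._<_ {N}) <-trans <-irrefl
    open ErdősRado (Fin._<_ {N}) <-trans <-irrefl

    module Planar
      (W : Fin k → Vector Carrier (3 ℕ.+ k)) (ys : List (Fin N))
      (nondegenerate : ∀ {a b c} → a ∈ ys → b ∈ ys → c ∈ ys → a Fin.< b → b Fin.< c →
                       ¬ (Bracket.bracket W (v a) (v b) (v c) ≈ 0#)) where

      open Bracket W

      ⟨_,_,_⟩ : Fin N → Fin N → Fin N → Carrier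
      ⟨ a , b , c ⟩ = bracket (v a) (v b) (v c)

      HomogeneousTriples : Sign → List (Fin N) → Set
      HomogeneousTriples s zs =
        ∀ {a b c} → a ∈ zs → b ∈ zs → c ∈ zs → a Fin.< b → b Fin.< c → HasSign s ⟨ a , b , c ⟩

      -- With o as point at infinity, the constant sign of ⟨ o , x , y ⟩ sorts the points by abscissa.
      triples : ∀ {o ε} n xs → o ∈ ys → All (o Fin.<_) xs → All (_∈ ys) xs → Sorted xs →
        AllPairs (λ x y → HasSign ε ⟨ o , x , y ⟩) xs → 2 ℕ.^ suc (n ℕ.+ n) ℕ.≤ length xs →
        ∃[ zs ] (n ℕ.≤ length zs × All (_∈ ys) zs × Sorted zs × ∃[ s ] HomogeneousTriples s zs)
      triples {o} {ε} n xs o∈ o< xs∈ sorted sign-ε le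
        with RamseyForTransitive.CupsCaps.homogeneous em (Fin._<_ {N}) <-trans <-irrefl (_∈ xs)
               (Colour Sign.+) (Colour Sign.-) (Colour-trans Sign.+) (Colour-trans Sign.-)
               Colour-total n xs sorted (All.tabulate λ z∈ → z∈) le
        where
        -- The colour records membership and order because transitivity is required for arbitrary
        -- points, while the Plücker relations need increasing, hence nondegenerate, triples from
        -- `xs`.
        Colour : Sign → Fin N → Fin N → Fin N → Set
        Colour s a b c = (a ∈ xs × b ∈ xs × c ∈ xs) × (a Fin.< b × b Fin.< c) × HasSign s ⟨ a , b , c ⟩
        nondegenerate′ : ∀ {a b c} → a ∈ xs → b ∈ xs → c ∈ xs → a Fin.< b → b Fin.< c → ¬ (⟨ a , b , c ⟩ ≈ 0#)
        nondegenerate′ a∈ b∈ c∈ = nondegenerate (All.lookup xs∈ a∈) (All.lookup xs∈ b∈) (All.lookup xs∈ c∈)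
        ε-sign : ∀ {x y} → x ∈ xs → y ∈ xs → x Fin.< y → HasSign ε ⟨ o , x , y ⟩
        ε-sign = AllPairs-lookup sorted sign-ε
        Colour-trans : ∀ s {a b c d} → Colour s a b c → Colour s b c d → Colour s a b d × Colour s a c d
        Colour-trans s {a} {b} {c} {d} ((a∈ , b∈ , c∈) , (a<b , b<c) , abc) ((_ , _ , d∈) , (_ , c<d) , bcd) =
          ( (a∈ , b∈ , d∈) , (a<b , b<d)
          , three-term-sign ε s (plücker-second (v o) (v a) (v b) (v c) (v d) abc≉0)
              (ε-sign b∈ c∈ b<c) (ε-sign a∈ b∈ a<b) (ε-sign b∈ d∈ b<d) bcd abc )
          ,
          ( (a∈ , c∈ , d∈) , (a<c , c<d)
          , three-term-sign ε s (plücker-third (v o) (v a) (v b) (v c) (v d) abc≉0)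
              (ε-sign b∈ c∈ b<c) (ε-sign a∈ c∈ a<c) (ε-sign c∈ d∈ c<d) bcd abc )
          where
          a<c = <-trans {a} {b} {c} a<b b<c
          b<d = <-trans {b} {c} {d} b<c c<d
          abc≉0 = nondegenerate′ a∈ b∈ c∈ a<b b<c
        Colour-total : ∀ {a b c} → a ∈ xs → b ∈ xs → c ∈ xs → a Fin.< b → b Fin.< c →
                       Colour Sign.+ a b c ⊎ Colour Sign.- a b c
        Colour-total {a} {b} {c} a∈ b∈ c∈ a<b b<c
          with sign ⟨ a , b , c ⟩ | sign-correct (nondegenerate′ a∈ b∈ c∈ a<b b<c)
        ... | Sign.+ | abc = inj₁ ((a∈ , b∈ , c∈) , (a<b , b<c) , abc)
        ... | Sign.- | abc = inj₂ ((a∈ , b∈ , c∈) , (a<b , b<c) , abc)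
      ... | zs , n≤ , zs∈ , sorted′ , inj₁ hom =
        zs , n≤ , All.map (All.lookup xs∈) zs∈ , sorted′ , Sign.+
        , λ a∈ b∈ c∈ a<b b<c → proj₂ (proj₂ (hom a∈ b∈ c∈ a<b b<c))
      ... | zs , n≤ , zs∈ , sorted′ , inj₂ hom =
        zs , n≤ , All.map (All.lookup xs∈) zs∈ , sorted′ , Sign.-
        , λ a∈ b∈ c∈ a<b b<c → proj₂ (proj₂ (hom a∈ b∈ c∈ a<b b<c))

      -- The common sign of ⟨ o , w , x ⟩ puts the directions from o into a half-plane,
      -- where the sign of ⟨ o , x , y ⟩ is transitive.
      pairs : ∀ {o w} σ l xs → o ∈ ys → w ∈ ys → o Fin.< w → All (_∈ ys) xs → All (w Fin.<_) xs → Sorted xs →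
        All (λ x → HasSign σ ⟨ o , w , x ⟩) xs → l ℕ.* l ℕ.< length xs →
        ∃[ zs ] ∃[ ε ] (l ℕ.≤ length zs × All (_∈ xs) zs × Sorted zs × AllPairs (λ x y → HasSign ε ⟨ o , x , y ⟩) zs)
      pairs {o} {w} σ l xs o∈ w∈ o<w xs∈ w<xs sorted sign-σ le = ascending
        (RamseyForTransitive.Pairs.monotone em (Fin._<_ {N}) <-trans <-irrefl (_∈ xs)
          (Colour Sign.+) (Colour Sign.-) (λ {x} {y} {z} → Colour-trans Sign.+ {x} {y} {z}) Colour-total
          l l xs sorted (All.tabulate λ z∈ → z∈) le)
        where
        Colour : Sign → Fin N → Fin N → Set
        Colour s x y = (x ∈ xs × y ∈ xs) × x Fin.< y × HasSign s ⟨ o , x , y ⟩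
        o< : ∀ {x} → x ∈ xs → o Fin.< x
        o< {x} x∈ = <-trans {o} {w} {x} o<w (All.lookup w<xs x∈)
        nondegenerate′ : ∀ {x y} → x ∈ xs → y ∈ xs → x Fin.< y → ¬ (⟨ o , x , y ⟩ ≈ 0#)
        nondegenerate′ x∈ y∈ x<y = nondegenerate o∈ (All.lookup xs∈ x∈) (All.lookup xs∈ y∈) (o< x∈) x<y
        Colour-trans : ∀ s {x y z} → Colour s x y → Colour s y z → Colour s x z
        Colour-trans s {x} {y} {z} ((x∈ , y∈) , x<y , oxy) ((_ , z∈) , y<z , oyz) =
          (x∈ , z∈) , <-trans {x} {y} {z} x<y y<z
          -- All three coefficients are brackets `⟨ o , w , _ ⟩` of sign `σ`, so the colours of
          -- `x y` and `y z` determine that of `x z`.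
          , three-term-sign σ s (plücker (v o) (v w) (v x) (v y) (v z) (nondegenerate′ x∈ y∈ x<y))
              (All.lookup sign-σ y∈) (All.lookup sign-σ x∈) (All.lookup sign-σ z∈) oyz oxy
        Colour-total : ∀ {x y} → x ∈ xs → y ∈ xs → x Fin.< y → Colour Sign.+ x y ⊎ Colour Sign.- x y
        Colour-total {x} {y} x∈ y∈ x<y with sign ⟨ o , x , y ⟩ | sign-correct (nondegenerate′ x∈ y∈ x<y)
        ... | Sign.+ | oxy = inj₁ ((x∈ , y∈) , x<y , oxy)
        ... | Sign.- | oxy = inj₂ ((x∈ , y∈) , x<y , oxy)
        ascending :
          (∃[ x ] ∃[ zs ] (length zs ≡ l × All (_∈ xs) (x ∷ zs) × AllPairs (flip (Colour Sign.+)) (x ∷ zs))) ⊎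
          (∃[ zs ] (length zs ≡ suc l × All (_∈ xs) zs × AllPairs (Colour Sign.-) zs)) →
          ∃[ zs ] ∃[ ε ] (l ℕ.≤ length zs × All (_∈ xs) zs × Sorted zs × AllPairs (λ x y → HasSign ε ⟨ o , x , y ⟩) zs)
        ascending (inj₁ (x , zs , len , zs∈ , chain)) =
          reverse (x ∷ zs) , Sign.+
          , ℕₚ.≤-trans (ℕₚ.m≤n⇒m≤1+n (ℕₚ.≤-reflexive (≡.sym len)))
              (ℕₚ.≤-reflexive (≡.sym (Listₚ.length-reverse (x ∷ zs))))
          , All.tabulate (λ z∈ → All.lookup zs∈ (Anyₚ.reverse⁻ z∈))
          , AllPairs-reverse (AllPairs.map (proj₁ ∘ proj₂) chain)
          , AllPairs-reverse (AllPairs.map (proj₂ ∘ proj₂) chain)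
        ascending (inj₂ (zs , len , zs∈ , chain)) =
          zs , Sign.- , ℕₚ.≤-trans (ℕₚ.n≤1+n l) (ℕₚ.≤-reflexive (≡.sym len)) , zs∈
          , AllPairs.map (proj₁ ∘ proj₂) chain , AllPairs.map (proj₂ ∘ proj₂) chain

      -- The first two points serve as `o` and `w`. Precedence of `o` and `w` over the rest makes
      -- the triples `o w x` and `o x y` increasing, so their brackets have a sign.
      planar : ∀ n l xs → Sorted xs → (∀ {x} → x ∈ xs → x ∈ ys) → 2 ℕ.^ suc (n ℕ.+ n) ℕ.≤ l →
        planarSize l ℕ.≤ length xs →
        ∃[ zs ] (n ℕ.≤ length zs × All (_∈ ys) zs × Sorted zs × ∃[ s ] HomogeneousTriples s zs)
      planar n l (o ∷ w ∷ xs) ((o<w ∷ o<xs) ∷ w<xs ∷ sorted) ⊆ys l≥ (s≤s (s≤s le)) =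
        let ds , ε , l≤ , ds∈ , sorted′ , sign-ε =
              pairs σ l half o∈ w∈ o<w (All.map (λ x∈ → ⊆ys (there (there x∈))) half∈)
                (All.map (All.lookup w<xs) half∈) (AllPairsₚ.filter⁺ σ? sorted) half-sign (proj₂ halving)
            ds∈xs = All-∈-filter⁻ σ? xs ds∈
        in triples {ε = ε} n ds o∈ (All.map (All.lookup o<xs) ds∈xs)
             (All.map (λ d∈ → ⊆ys (there (there d∈))) ds∈xs) sorted′ sign-ε (ℕₚ.≤-trans l≥ l≤)
        where
        halving = constant-half (λ x → sign ⟨ o , w , x ⟩) xs le
        σ = proj₁ halving
        σ? = λ x → sign ⟨ o , w , x ⟩ Signₚ.≟ σ
        half = filter σ? xs
        o∈ = ⊆ys (here ≡.refl)
        w∈ = ⊆ys (there (here ≡.refl))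
        half∈ : All (_∈ xs) half
        half∈ = All-∈-filter⁻ σ? xs (All.tabulate λ z∈ → z∈)
        half-sign : All (λ x → HasSign σ ⟨ o , w , x ⟩) half
        half-sign = All.tabulate λ {x} x∈ → let x∈xs , eq = ∈-filter⁻ σ? {xs = xs} x∈ in
          ≡.subst (λ s → HasSign s ⟨ o , w , x ⟩) eq
            (sign-correct (nondegenerate o∈ w∈ (⊆ys (there (there x∈xs))) o<w (All.lookup w<xs x∈xs)))

    private
      tupleDet≈bracket : ∀ (ws : Vec (Fin N) k) a b c →
        tupleDet (a ∷ b ∷ c ∷ ws) ≈ Bracket.bracket (λ j → v (lookup ws j)) (v a) (v b) (v c)
      tupleDet≈bracket ws a b c = det-cong columnwise
        where
        columnwise : ∀ i j → v (lookup (a ∷ b ∷ c ∷ ws) j) i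
                           ≈ Bracket.columns (λ j → v (lookup ws j)) (v a) (v b) (v c) i j
        columnwise i zero                = refl
        columnwise i (suc zero)          = refl
        columnwise i (suc (suc zero))    = refl
        columnwise i (suc (suc (suc j))) = refl

      increasing : ∀ {ys} (ws : Vec (Fin N) k) → Increasing ws → All (λ y → VecAll (y Fin.<_) ws) ys →
        ∀ {a b c} → a ∈ ys → b ∈ ys → c ∈ ys → a Fin.< b → b Fin.< c → Increasing (a ∷ b ∷ c ∷ ws)
      increasing ws sorted-ws ys<ws {a} {b} {c} a∈ b∈ c∈ a<b b<c =
        (a<b ∷ <-trans {a} {b} {c} a<b b<c ∷ All.lookup ys<ws a∈) ∷ (b<c ∷ All.lookup ys<ws b∈) ∷
        All.lookup ys<ws c∈ ∷ sorted-ws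

    -- After the reduction, the sign of an increasing tuple from `ys` is that of its first three
    -- members completed by `ws`, a bracket with fixed `W`. Making these brackets agree therefore
    -- makes all tuples agree.
    homogeneous-tuples : (∀ us → Increasing us → ¬ (tupleDet us ≈ 0#)) →
      ∀ n l → 2 ℕ.^ suc (n ℕ.+ n) ℕ.≤ l → iterated k (planarSize l) ℕ.≤ N →
      ∃[ zs ] (n ℕ.≤ length zs × Sorted zs ×
        ∃[ s ] (∀ us → VecAll (_∈ zs) us → Increasing us → HasSign s (tupleDet us)))
    homogeneous-tuples nondegenerate n l l≥ le =
      let ys , ws , M≤ , _ , sorted , _ , sorted-ws , ys<ws , first-three =
            reduce-to-triples k (λ us → sign (tupleDet us)) _ (allFin N) (AllPairsₚ.tabulate⁺-< (λ i<j → i<j))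
              (ℕₚ.≤-trans le (ℕₚ.≤-reflexive (≡.sym (Listₚ.length-tabulate (λ i → i)))))
      in lift ys ws sorted M≤ (increasing ws sorted-ws ys<ws) first-three
      where
      lift : ∀ ys ws → Sorted ys → planarSize l ℕ.≤ length ys →
        (∀ {a b c} → a ∈ ys → b ∈ ys → c ∈ ys → a Fin.< b → b Fin.< c → Increasing (a ∷ b ∷ c ∷ ws)) →
        (∀ a b c us → VecAll (_∈ ys) (a ∷ b ∷ c ∷ us) → Increasing (a ∷ b ∷ c ∷ us) →
          sign (tupleDet (a ∷ b ∷ c ∷ us)) ≡ sign (tupleDet (a ∷ b ∷ c ∷ ws))) →
        ∃[ zs ] (n ℕ.≤ length zs × Sorted zs ×
          ∃[ s ] (∀ us → VecAll (_∈ zs) us → Increasing us → HasSign s (tupleDet us)))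
      lift ys ws sorted M≤ inc-ws first-three =
        let zs , n≤ , zs∈ , sorted-zs , s , hom =
              Planar.planar W ys nondegenerate′ n l ys sorted (λ z∈ → z∈) l≥ M≤
        in zs , n≤ , sorted-zs , s , result zs zs∈ s hom
        where
        W : Fin k → Vector Carrier (3 ℕ.+ k)
        W j = v (lookup ws j)
        nondegenerate′ : ∀ {a b c} → a ∈ ys → b ∈ ys → c ∈ ys → a Fin.< b → b Fin.< c →
                         ¬ (Bracket.bracket W (v a) (v b) (v c) ≈ 0#)
        nondegenerate′ {a} {b} {c} a∈ b∈ c∈ a<b b<c eq =
          nondegenerate (a ∷ b ∷ c ∷ ws) (inc-ws a∈ b∈ c∈ a<b b<c) (trans (tupleDet≈bracket ws a b c) eq)
        result : ∀ zs → All (_∈ ys) zs → ∀ s → Planar.HomogeneousTriples W ys nondegenerate′ s zs →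
                 ∀ us → VecAll (_∈ zs) us → Increasing us → HasSign s (tupleDet us)
        result zs zs∈ s hom us@(a ∷ b ∷ c ∷ us′) us∈@(a∈ ∷ b∈ ∷ c∈ ∷ _) inc@((a<b ∷ _) ∷ (b<c ∷ _) ∷ _) =
          ≡.subst (λ t → HasSign t (tupleDet us))
            (≡.trans (first-three a b c us′ (VecAll.map (All.lookup zs∈) us∈) inc) (≡.sym s≡))
            (sign-correct (nondegenerate us inc))
          where
          abcws : HasSign s (tupleDet (a ∷ b ∷ c ∷ ws))
          abcws = sign-resp-≈ s (sym (tupleDet≈bracket ws a b c)) (hom a∈ b∈ c∈ a<b b<c)
          s≡ : s ≡ sign (tupleDet (a ∷ b ∷ c ∷ ws))
          s≡ = sign-unique s _ abcws (sign-correct (sign⇒≉0 s abcws))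

  -- From vectors back to points

  differences : ∀ {d} → (Fin (suc d) → Vector Carrier d) → Matrix d
  differences p i j = p (suc j) i + - p zero i

  -- A vector orthogonal to all differences is the normal of a hyperplane through all points.
  singular⇒normal : ∀ {d} (p : Fin (suc d) → Vector Carrier d) → det (differences p) ≈ 0# →
    ∃[ a ] (¬ (∀ i → a i ≈ 0#) × ∀ k → dot a (p k) ≈ dot a (p zero))
  singular⇒normal p det≈0 =
    let a , a≉0 , a⊥ = singular⇒kernel-nontrivial (differences p) det≈0
    in a , a≉0 , λ { zero → refl ; (suc j) → x∙y⁻¹≈ε⇒x≈y _ _
         (trans (sym (dot-difference a (p (suc j)) (p zero))) (a⊥ j)) }

  homogeneous-points : ExcludedMiddle 0ℓ → ∀ {k N} (P : Fin N → Vector Carrier (2 ℕ.+ k)) →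
    (∀ ι → ι Preserves Fin._<_ ⟶ Fin._<_ → ¬ (det (differences (P ∘ ι)) ≈ 0#)) →
    ∀ n l → 2 ℕ.^ suc (n ℕ.+ n) ℕ.≤ l → iterated k (planarSize l) ℕ.≤ N →
    Σ (Fin n → Fin N) λ σ → σ Preserves Fin._<_ ⟶ Fin._<_ ×
      ∃[ s ] (∀ ι → ι Preserves Fin._<_ ⟶ Fin._<_ → HasSign s (det (differences (P ∘ σ ∘ ι))))
  homogeneous-points em {k} {N} P regular n l l≥ le =
    let zs , n≤ , sorted , s , hom =
          Homogeneity.homogeneous-tuples em (homogenize ∘ P)
            (λ us inc eq → regular (lookup us) (VecAllPairs-lookup inc)
              (trans (sym (det-homogenize (P ∘ lookup us))) eq)) n l l≥ le
        σ : Fin n → Fin N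
        σ i = List.lookup zs (inject≤ i n≤)
        σ-increasing : σ Preserves Fin._<_ ⟶ Fin._<_
        σ-increasing = λ {i} {j} i<j → AllPairs-lookup-< sorted
          (≡.subst₂ ℕ._<_ (≡.sym (Finₚ.toℕ-inject≤ i n≤)) (≡.sym (Finₚ.toℕ-inject≤ j n≤)) i<j)
    in σ , σ-increasing , s , λ ι inc → sign-resp-≈ s
         (trans (det-cong λ i j → reflexive (≡.cong (λ x → homogenize (P x) i) (Vecₚ.lookup∘tabulate (σ ∘ ι) j)))
                (det-homogenize (P ∘ σ ∘ ι)))
         (hom (tabulate (σ ∘ ι)) (VecAllₚ.tabulate⁺ λ j → ∈-lookup (inject≤ (ι j) n≤))
           (VecAllPairs-tabulate (σ ∘ ι) (σ-increasing ∘ inc)))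

-- Order types

module OrderTypes (em : ExcludedMiddle 0ℓ) where

  open Defs using (0ℝ; _≈_; det; Points; StrictlyIncreasing; GeneralPosition; differences;
                   HasOrientation; HomogeneousUnavoidable)
  open RealRing using (ℝ-commutativeRing; 0<-resp-≈; 0<-+; 0<-*; 0≮0; 0<1; trichotomy; 0<-⇒negative)

  open import Data.Nat.Base using (_+_; _^_; _≤_)
  open Towers using (iterated; planarSize)

  ℝ-positiveCone : PositiveCone ℝ-commutativeRing
  ℝ-positiveCone = record
    { Positive        = 0ℝ Defs.<_
    ; positive-resp-≈ = λ {x} {y} → 0<-resp-≈ {x} {y}
    ; positive-+      = λ {x} {y} → 0<-+ {x} {y}
    ; positive-*      = λ {x} {y} → 0<-* {x} {y}
    ; 0-not-positive  = 0≮0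
    ; 1-positive      = 0<1
    ; trichotomy      = trichotomy em
    }

  module R = OrderedRing ℝ-commutativeRing ℝ-positiveCone

  hasOrientation : ∀ {d} (p : Points d (suc d)) s → R.HasSign s (det (differences p)) → HasOrientation p s
  hasOrientation p Sign.+ h = h
  hasOrientation p Sign.- h = 0<-⇒negative {det (differences p)} h

  -- General position enters here: a vanishing determinant yields a kernel vector, the normal of a
  -- hyperplane through the first point that contains all the others.
  regular : ∀ {d N} {P : Points d N} → GeneralPosition P →
    (ι : Fin (suc d) → Fin N) → StrictlyIncreasing ι → ¬ (det (differences (P ∘ ι)) ≈ 0ℝ)
  regular {P = P} gp ι inc det≈0 =
    let a , a≉0 , on = R.singular⇒normal (P ∘ ι) det≈0
    in GeneralPosition.noCommonHyperplane gp ι inc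
         (record { normal = a ; offset = Defs.dot a (P (ι zero)) ; normal≉0 = a≉0 } , on)

  unavoidable : ∀ k n N → iterated k (planarSize (2 ^ suc (n + n))) ≤ N →
    HomogeneousUnavoidable (2 + k) n N
  unavoidable k n N le P gp =
    let σ , σ-increasing , s , hom = R.homogeneous-points em P (regular gp) n (2 ^ suc (n + n)) ℕₚ.≤-refl le
    in σ , σ-increasing , s , λ ι inc → hasOrientation (P ∘ σ ∘ ι) s (hom ι inc)

-- The least unavoidable length

open import Data.Nat.Base using (_*_; _≤_; _<_)

-- An upper bound alone does not produce the value of `OT`. Starting from the bound, one descends as
-- long as a smaller witness exists, which excluded middle decides; well-foundedness stops the
-- descent.
least : ExcludedMiddle 0ℓ → ∀ {Q : ℕ → Set} N → Q N →
        ∃[ M ] ((Q M × ∀ L → Q L → M ≤ L) × M ≤ N)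
least em {Q} = <-rec _ λ N rec QN → decide N (λ {M} → rec {M}) QN
  where
  decide : ∀ N → (∀ {M} → M < N → Q M → ∃[ K ] ((Q K × ∀ L → Q L → K ≤ L) × K ≤ M)) →
           Q N → ∃[ K ] ((Q K × ∀ L → Q L → K ≤ L) × K ≤ N)
  decide N rec QN with em {∃[ M ] (M < N × Q M)}
  ... | yes (M , M<N , QM) =
    let K , isLeast , K≤M = rec M<N QM in K , isLeast , ℕₚ.≤-trans K≤M (ℕₚ.<⇒≤ M<N)
  ... | no none = N , (QN , λ L QL → ℕₚ.≮⇒≥ λ L<N → none (L , L<N , QL)) , ℕₚ.≤-refl

theorem1p3 : ExcludedMiddle 0ℓ →
    ∀ (d : ℕ) → 2 ≤ d →
    ∃[ c ] (0 < c ×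
    (∀ (n : ℕ) → 1 ≤ n → ∃[ N ] (IsOT d n N × N ≤ twr d (c * n))))
theorem1p3 em (suc (suc k)) _ with Towers.iterated≤twr k
... | c , 0<c , bound = c , 0<c , λ n 1≤n →
  least em (twr (2 ℕ.+ k) (c * n)) (OrderTypes.unavoidable em k n _ (bound n 1≤n))
theorem1p3 em 1 (s≤s ())
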